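{- Let $q_1,q_2\in\mathbb Q_{>0}$, $a_1,a_2,b_1,b_2\in\mathbb N$ and $n_1,n_2,m_1,m_2\in\mathbb Z$. If the pattern $$x,\quad y,\quad q_1(a_1x+n_1)(b_1y+m_1),\quad q_2(a_2x+n_2)(b_2y+m_2)$$ is partition regular, then at least one of the following holds (equalities being identities of polynomials in $x,y$): 1. $q_1(a_1x+n_1)(b_1y+m_1)=q_2(a_2x+n_2)(b_2y+m_2)$; 2. $q_1(a_1x+n_1)(b_1y+m_1)=q_2(b_2x+m_2)(a_2y+n_2)$; 3. $q_1a_1b_1=q_2a_2b_2$ and, setting $q:=q_1a_1b_1=q_2a_2b_2$, the pattern is $x,\ y,\ qxy,\ qxy+x$ or the symmetric one $x,\ y,\ qxy,\ qxy+y$ (up to the order in which the terms are listed).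
   Context: $\mathbb N$ denotes the set of positive integers ($0\notin\mathbb N$). A pattern $f_1(x,y),\dots,f_k(x,y)$ (with the $f_i$ rational-valued functions) is called partition regular if, for every finite colouring (partition into finitely many pieces) of $\mathbb N$, the set of monochromatic $k$-tuples $(f_1(u,v),\dots,f_k(u,v))$ with $u,v\in\mathbb N$ is infinite; here a tuple is monochromatic if all its entries belong to $\mathbb N$ and lie in the same colour. -}

module Defs where

open import Data.Fin using (Fin)
open import Data.Integer using (ℤ; +_)
open import Data.List using (List; map)
open import Data.List.Membership.Propositional using (_∈_)
open import Data.List.Relation.Unary.All using (All)
open import Data.Nat using (ℕ; NonZero)
open import Data.Product using (Σ; ∃; ∃-syntax; _×_; _,_)
open import Data.Rational using (ℚ; _+_; _*_; _/_)
open import Relation.Binary.PropositionalEquality using (_≡_; _→-setoid_)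
open import Relation.Nullary using (¬_)
open import Relation.Unary using (Pred; _⊆_)
import Data.List.Relation.Binary.Permutation.Setoid as Permutation

fromℤ : ℤ → ℚ
fromℤ i = i / 1

fromℕ : ℕ → ℚ
fromℕ n = fromℤ (+ n)

-- Since ℚ is infinite, an identity between two polynomials in x and y
-- over ℚ is a pointwise equality (_≗_) of such functions.
Function₂ : Set
Function₂ = ℚ × ℚ → ℚ

Pattern : Set
Pattern = List Function₂

open Permutation ((ℚ × ℚ) →-setoid ℚ) public using (_↭_)

Infinite : ∀ {a ℓ} {A : Set a} → Pred A ℓ → Set _
Infinite P = ¬ (∃[ xs ] P ⊆ (_∈ xs))

-- The colour is independent of the proof of positivity, as that argument
-- is irrelevant; zero is not coloured.
Colouring : ℕ → Set
Colouring r = (n : ℕ) → .{{_ : NonZero n}} → Fin r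

HasColour : ∀ {r} → Colouring r → Fin r → ℚ → Set
HasColour c k z =
  ∃[ n ] Σ (NonZero n) λ n≢0 → z ≡ fromℕ n × c n {{n≢0}} ≡ k

MonochromaticTuple : ∀ {r} → Colouring r → Pattern → List ℚ → Set
MonochromaticTuple c fs t =
  (∃[ u ] ∃[ v ] NonZero u × NonZero v ×
    t ≡ map (λ f → f (fromℕ u , fromℕ v)) fs) ×
  (∃[ k ] All (HasColour c k) t)

PartitionRegular : Pattern → Set
PartitionRegular fs =
  ∀ {r} (c : Colouring r) → Infinite (MonochromaticTuple c fs)

X Y : Function₂
X (x , y) = x
Y (x , y) = y

bilinear : ℚ → ℕ → ℤ → ℕ → ℤ → Function₂
bilinear q a n b m (x , y) =
  q * (fromℕ a * x + fromℤ n) * (fromℕ b * y + fromℤ m)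

{-# OPTIONS --safe #-}

-- Clearing denominators, a monochromatic tuple (x, y, z, w) satisfies
--   D z = C₁ x y + E₁ x + G₁ y + H₁,   D w = C₂ x y + E₂ x + G₂ y + H₂,   Cᵢ Hᵢ = Eᵢ Gᵢ.
-- If C₁ ≠ C₂, then z / w stays away from 1 and bounded, which the colouring by a rounded logarithm
-- modulo a constant excludes. If C₁ = C₂ = C, put L = E₁ + G₁ - E₂ - G₂. Colouring by residues forces
-- either L = 0, where (E₁, G₁) and (E₂, G₂) have the same sum and product, or x ≡ y ≡ z ≡ w ≡ r modulo
-- any given number for some integer r. Translating by r removes the constant terms and makes
-- E₁ G₁ = C D r = E₂ G₂. Let p be a large prime, and colour by the last nonzero digit in base p
-- and, for n = p^s u with p ∤ u, by the digits of u in the places s - 1 and s. Comparing the valuations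
-- s of x and t of y, s < t gives Eᵢ ∈ {0, D}, t < s gives Gᵢ ∈ {0, D}, and s = t gives Eᵢ + Gᵢ = 0:
-- the last nonzero digits only give Eᵢ + Gᵢ ∈ {0, D}, but if Eᵢ + Gᵢ = D then the term C x y, of
-- valuation 2 s, is visible in the other two digits.
module Submission where

open import Defs
open import Data.Empty using (⊥; ⊥-elim)
open import Data.Fin as Fin using (Fin)
import Data.Fin.Properties as Fin
open import Data.Integer using (ℤ)
open import Data.Integer as ℤ using (+_; ∣_∣; 0ℤ; 1ℤ) renaming (_+_ to _+ᶻ_; _*_ to _*ᶻ_; _-_ to _-ᶻ_; -_ to -ᶻ_)
import Data.Integer.Properties as ℤ
open import Data.Integer.Divisibility.Signed as ∣ᶻ using (divides) renaming (_∣_ to _∣ᶻ_; _∣?_ to _∣ᶻ?_)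
open import Data.Integer.Tactic.RingSolver using (solve-∀)
open import Data.List using (List; []; _∷_; map; replicate; upTo)
open import Data.List.Membership.Propositional using (_∈_)
open import Data.List.Membership.Propositional.Properties using (∈-map⁺; ∈-upTo⁺)
open import Data.List.Relation.Binary.Pointwise using ([]; _∷_)
import Data.List.Relation.Binary.Permutation.Homogeneous as ↭
open import Data.List.Relation.Unary.All using ([]; _∷_)
open import Data.Nat using (ℕ; NonZero)
open import Data.Nat as ℕ using (zero; suc; _≤_; _<_; z≤n; s≤s; _^_; _!)
import Data.Nat.Properties as ℕ
import Data.Nat.DivMod as ℕ
import Data.Nat.Divisibility as ℕ
open import Data.Nat.Induction using (<-rec)
open import Data.Nat.Primality using (Prime; euclidsLemma; prime⇒nonZero; prime⇒nonTrivial; ¬prime[1])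
open import Data.Nat.Primality.Factorisation using (factorise; module PrimeFactorisation)
open import Data.Nat.Tactic.RingSolver using () renaming (solve-∀ to solveℕ-∀)
open import Data.Product using (Σ; ∃; ∃₂; _×_; _,_; proj₁; proj₂)
open import Data.Rational using (ℚ; Positive; _+_; _*_)
open import Data.Rational as ℚ using (mkℚ; 0ℚ)
import Data.Rational.Properties as ℚ
open import Data.Rational.Unnormalised as ℚᵘ using (mkℚᵘ; *≡*)
import Data.Rational.Unnormalised.Properties as ℚᵘ
open import Data.Sum using (_⊎_; inj₁; inj₂; [_,_]′; map₁; map₂)
open import Function using (_∘_)
open import Level using (0ℓ)
open import Relation.Binary.Definitions using (Tri; tri<; tri≈; tri>)
open import Relation.Binary.PropositionalEquality
open import Relation.Nullary using (¬_; Dec; yes; no; contradiction)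
open import Relation.Nullary.Decidable using (dec⇒maybe; decidable-stable; _×-dec_; _⊎-dec_)
open import Tactic.RingSolver using () renaming (solve-∀ to solve-ring)
open import Tactic.RingSolver.Core.AlmostCommutativeRing using (AlmostCommutativeRing; fromCommutativeRing)

-- The hard case is `s = t` with `E + G = D`. Division by `p^s` turns the equation into
-- `D (m - u) - G (v - u) = C p^s u v` for the parts `u`, `v`, `m` prime to `p`, and modulo a fixed
-- power of `p` the right side disappears once `s` is large. The product first shows in place `s`,
-- which varies with the number, so the colour must read digits at a position given by the
-- valuation. The digit in place `s` alone would locate `u`, `v`, `m` up to an error below `p^s`,
-- which the coefficients could magnify to a nonzero multiple of `p^s`; adding the place `s - 1`
-- shrinks the error by the factor `p`, which exceeds `∣ D ∣ + ∣ G ∣`. The number `r` solves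
-- `f (r, r) = D r` for both quadratics `f`: the constant term left by the translation is divisible
-- by `p` and smaller than `p`. This is why the two translated products agree. If they vanish, then
-- `r = 0` and nothing was translated; the exceptional patterns with `q x y` arise exactly there.

-- Congruences and approximate digits

∣∣<⇒≡0 : ∀ {k i} → + k ∣ᶻ i → ∣ i ∣ < k → i ≡ 0ℤ
∣∣<⇒≡0 {k} {i} k∣i i<k with ∣ i ∣ in eq | ∣ᶻ.∣⇒∣ᵤ k∣i
... | zero  | _ = ℤ.∣i∣≡0⇒i≡0 eq
... | suc n | d = contradiction i<k (ℕ.≤⇒≯ (ℕ.∣⇒≤ d))

euclidean : ∀ k j .{{_ : NonZero k}} → + j ≡ + (j ℕ.% k) +ᶻ + (j ℕ./ k) *ᶻ + k
euclidean k j = begin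
  + j                                     ≡⟨ cong +_ (ℕ.m≡m%n+[m/n]*n j k) ⟩
  + (j ℕ.% k ℕ.+ (j ℕ./ k) ℕ.* k)         ≡⟨ ℤ.pos-+ (j ℕ.% k) _ ⟩
  + (j ℕ.% k) +ᶻ + ((j ℕ./ k) ℕ.* k)      ≡⟨ cong (+ (j ℕ.% k) +ᶻ_) (ℤ.pos-* (j ℕ./ k) k) ⟩
  + (j ℕ.% k) +ᶻ + (j ℕ./ k) *ᶻ + k       ∎
  where open ≡-Reasoning

mod-≡⇒∣ : ∀ m n k .{{_ : NonZero k}} → m ℕ.mod k ≡ n ℕ.mod k → + k ∣ᶻ + m -ᶻ + n
mod-≡⇒∣ m n k eq = divides (+ (m ℕ./ k) -ᶻ + (n ℕ./ k)) (begin
  + m -ᶻ + n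
    ≡⟨ cong₂ _-ᶻ_ (euclidean k m) (euclidean k n) ⟩
  (+ (m ℕ.% k) +ᶻ + (m ℕ./ k) *ᶻ + k) -ᶻ (+ (n ℕ.% k) +ᶻ + (n ℕ./ k) *ᶻ + k)
    ≡⟨ cong (λ r → (+ r +ᶻ + (m ℕ./ k) *ᶻ + k) -ᶻ (+ (n ℕ.% k) +ᶻ + (n ℕ./ k) *ᶻ + k)) same ⟩
  (+ (n ℕ.% k) +ᶻ + (m ℕ./ k) *ᶻ + k) -ᶻ (+ (n ℕ.% k) +ᶻ + (n ℕ./ k) *ᶻ + k)
    ≡⟨ cancel (+ (n ℕ.% k)) (+ (m ℕ./ k)) (+ (n ℕ./ k)) (+ k) ⟩
  (+ (m ℕ./ k) -ᶻ + (n ℕ./ k)) *ᶻ + k ∎)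
  where
  open ≡-Reasoning
  same : m ℕ.% k ≡ n ℕ.% k
  same = begin
    m ℕ.% k                 ≡⟨ Fin.toℕ-fromℕ< (ℕ.m%n<n m k) ⟨
    Fin.toℕ (m ℕ.mod k)     ≡⟨ cong Fin.toℕ eq ⟩
    Fin.toℕ (n ℕ.mod k)     ≡⟨ Fin.toℕ-fromℕ< (ℕ.m%n<n n k) ⟩
    n ℕ.% k                 ∎
  cancel : ∀ r a b d → (r +ᶻ a *ᶻ d) -ᶻ (r +ᶻ b *ᶻ d) ≡ (a -ᶻ b) *ᶻ d
  cancel = solve-∀

-- Euclid's argument: a prime factor of `n ! + 1` that is at most `n` would divide `n !` and hence
-- 1.
infinitudeOfPrimes : ∀ n → ∃ λ p → Prime p × n < p
infinitudeOfPrimes n with factorise (suc (n !))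
... | record { factors = [] ; isFactorisation = eq } =
  contradiction (ℕ.suc-injective eq) (ℕ.≢-nonZero⁻¹ (n !) {{ n ℕ.!≢0 }})
... | record { factors = p ∷ ps ; isFactorisation = eq ; factorsPrime = p-prime ∷ _ } =
  p , p-prime , ℕ.≰⇒> λ p≤n → ¬prime[1] (subst Prime (ℕ.∣1⇒≡1 (p∣1 p≤n)) p-prime)
  where
  p∣1 : p ≤ n → p ℕ.∣ 1
  p∣1 p≤n = ℕ.∣m+n∣m⇒∣n
    (subst (p ℕ.∣_) (trans (sym eq) (ℕ.+-comm 1 (n !))) (ℕ.m∣m*n _))
    (ℕ.∣-trans (n∣n! p {{prime⇒nonZero p-prime}}) (ℕ.m≤n⇒m!∣n! p≤n))
    where
    n∣n! : ∀ n → .{{NonZero n}} → n ℕ.∣ n !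
    n∣n! (suc n) = ℕ.m∣m*n (n !)

-- The point of the digits ⌊u/q⌋ mod N is that they locate u modulo q N up to an error below q.
same-digits⇒close : ∀ u v q N .{{_ : NonZero q}} .{{_ : NonZero N}} →
  (u ℕ./ q) ℕ.mod N ≡ (v ℕ./ q) ℕ.mod N →
  ∃₂ λ ε k → + v -ᶻ + u ≡ ε +ᶻ k *ᶻ (+ q *ᶻ + N) × ∣ ε ∣ < q
same-digits⇒close u v q N eq = close (mod-≡⇒∣ (v ℕ./ q) (u ℕ./ q) N (sym eq))
  where
  close : + N ∣ᶻ + (v ℕ./ q) -ᶻ + (u ℕ./ q) → ∃₂ λ ε k → + v -ᶻ + u ≡ ε +ᶻ k *ᶻ (+ q *ᶻ + N) × ∣ ε ∣ < q
  close (divides k quot) = + (v ℕ.% q) -ᶻ + (u ℕ.% q) , k , (begin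
    + v -ᶻ + u
      ≡⟨ cong₂ _-ᶻ_ (euclidean q v) (euclidean q u) ⟩
    (rv +ᶻ qv *ᶻ + q) -ᶻ (ru +ᶻ qu *ᶻ + q)
      ≡⟨ regroup rv ru qv qu (+ q) ⟩
    (rv -ᶻ ru) +ᶻ (qv -ᶻ qu) *ᶻ + q
      ≡⟨ cong (λ t → (rv -ᶻ ru) +ᶻ t *ᶻ + q) quot ⟩
    (rv -ᶻ ru) +ᶻ (k *ᶻ + N) *ᶻ + q
      ≡⟨ reassoc (rv -ᶻ ru) k (+ N) (+ q) ⟩
    (rv -ᶻ ru) +ᶻ k *ᶻ (+ q *ᶻ + N) ∎) , small
    where
    open ≡-Reasoning
    rv = + (v ℕ.% q)
    ru = + (u ℕ.% q)
    qv = + (v ℕ./ q)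
    qu = + (u ℕ./ q)
    small : ∣ rv -ᶻ ru ∣ < q
    small = ℕ.≤-<-trans
      (ℕ.≤-trans (ℕ.≤-reflexive (cong ∣_∣ (ℤ.m-n≡m⊖n (v ℕ.% q) (u ℕ.% q))))
                 (ℤ.∣m⊝n∣≤m⊔n (v ℕ.% q) (u ℕ.% q)))
      (ℕ.⊔-lub (ℕ.m%n<n v q) (ℕ.m%n<n u q))
    regroup : ∀ a b c d e → (a +ᶻ c *ᶻ e) -ᶻ (b +ᶻ d *ᶻ e) ≡ (a -ᶻ b) +ᶻ (c -ᶻ d) *ᶻ e
    regroup = solve-∀
    reassoc : ∀ a k n q → a +ᶻ (k *ᶻ n) *ᶻ q ≡ a +ᶻ k *ᶻ (q *ᶻ n)
    reassoc = solve-∀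

-- With `D - G` as the coefficient of `u`, the linear terms depend only on the differences `m - u`
-- and `v - u`. The modulus `q p²` and the coefficient `C p q` share the factor `p q`, which
-- therefore divides what the errors contribute.
error-multiple : ∀ {C D G p q u v m ε δ k l} →
  v -ᶻ u ≡ ε +ᶻ k *ᶻ (q *ᶻ (p *ᶻ p)) → m -ᶻ u ≡ δ +ᶻ l *ᶻ (q *ᶻ (p *ᶻ p)) →
  D *ᶻ m ≡ C *ᶻ (p *ᶻ q) *ᶻ u *ᶻ v +ᶻ (D -ᶻ G) *ᶻ u +ᶻ G *ᶻ v →
  D *ᶻ δ -ᶻ G *ᶻ ε ≡ (C *ᶻ u *ᶻ v -ᶻ p *ᶻ (D *ᶻ l -ᶻ G *ᶻ k)) *ᶻ (p *ᶻ q)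
error-multiple {C} {D} {G} {p} {q} {u} {v} {m} {ε} {δ} {k} {l} v-u m-u eq = begin
  D *ᶻ δ -ᶻ G *ᶻ ε
    ≡⟨ expand D G δ ε k l (q *ᶻ (p *ᶻ p)) ⟩
  (D *ᶻ (δ +ᶻ l *ᶻ (q *ᶻ (p *ᶻ p))) -ᶻ G *ᶻ (ε +ᶻ k *ᶻ (q *ᶻ (p *ᶻ p)))) -ᶻ (D *ᶻ l -ᶻ G *ᶻ k) *ᶻ (q *ᶻ (p *ᶻ p))
    ≡⟨ cong₂ (λ a b → (D *ᶻ a -ᶻ G *ᶻ b) -ᶻ (D *ᶻ l -ᶻ G *ᶻ k) *ᶻ (q *ᶻ (p *ᶻ p))) m-u v-u ⟨
  (D *ᶻ (m -ᶻ u) -ᶻ G *ᶻ (v -ᶻ u)) -ᶻ (D *ᶻ l -ᶻ G *ᶻ k) *ᶻ (q *ᶻ (p *ᶻ p))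
    ≡⟨ gather D G m u v ((D *ᶻ l -ᶻ G *ᶻ k) *ᶻ (q *ᶻ (p *ᶻ p))) ⟩
  (D *ᶻ m -ᶻ ((D -ᶻ G) *ᶻ u +ᶻ G *ᶻ v)) -ᶻ (D *ᶻ l -ᶻ G *ᶻ k) *ᶻ (q *ᶻ (p *ᶻ p))
    ≡⟨ cong (λ a → (a -ᶻ ((D -ᶻ G) *ᶻ u +ᶻ G *ᶻ v)) -ᶻ (D *ᶻ l -ᶻ G *ᶻ k) *ᶻ (q *ᶻ (p *ᶻ p))) eq ⟩
  ((C *ᶻ (p *ᶻ q) *ᶻ u *ᶻ v +ᶻ (D -ᶻ G) *ᶻ u +ᶻ G *ᶻ v) -ᶻ ((D -ᶻ G) *ᶻ u +ᶻ G *ᶻ v))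
    -ᶻ (D *ᶻ l -ᶻ G *ᶻ k) *ᶻ (q *ᶻ (p *ᶻ p))
    ≡⟨ collect C (D -ᶻ G) G p q u v (D *ᶻ l -ᶻ G *ᶻ k) ⟩
  (C *ᶻ u *ᶻ v -ᶻ p *ᶻ (D *ᶻ l -ᶻ G *ᶻ k)) *ᶻ (p *ᶻ q) ∎
  where
  open ≡-Reasoning
  expand : ∀ D G δ ε k l M → D *ᶻ δ -ᶻ G *ᶻ ε ≡
    (D *ᶻ (δ +ᶻ l *ᶻ M) -ᶻ G *ᶻ (ε +ᶻ k *ᶻ M)) -ᶻ (D *ᶻ l -ᶻ G *ᶻ k) *ᶻ M
  expand = solve-∀
  gather : ∀ D G m u v N → (D *ᶻ (m -ᶻ u) -ᶻ G *ᶻ (v -ᶻ u)) -ᶻ N ≡ (D *ᶻ m -ᶻ ((D -ᶻ G) *ᶻ u +ᶻ G *ᶻ v)) -ᶻ N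
  gather = solve-∀
  collect : ∀ C E G p q u v K →
    ((C *ᶻ (p *ᶻ q) *ᶻ u *ᶻ v +ᶻ E *ᶻ u +ᶻ G *ᶻ v) -ᶻ (E *ᶻ u +ᶻ G *ᶻ v)) -ᶻ K *ᶻ (q *ᶻ (p *ᶻ p)) ≡
    (C *ᶻ u *ᶻ v -ᶻ p *ᶻ K) *ᶻ (p *ᶻ q)
  collect = solve-∀

-- D (m - u) - G (v - u) = C p q u v is congruent modulo q p² to D δ - G ε, which is therefore a
-- multiple of p q. Being smaller than p q, it vanishes.
close⇒∣ : ∀ p q .{{_ : NonZero p}} .{{_ : NonZero q}} (C D G u v m ε δ k l : ℤ) →
  ∣ D ∣ ℕ.+ ∣ G ∣ < p → ∣ ε ∣ < q → ∣ δ ∣ < q →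
  v -ᶻ u ≡ ε +ᶻ k *ᶻ (+ q *ᶻ (+ p *ᶻ + p)) → m -ᶻ u ≡ δ +ᶻ l *ᶻ (+ q *ᶻ (+ p *ᶻ + p)) →
  D *ᶻ m ≡ C *ᶻ (+ p *ᶻ + q) *ᶻ u *ᶻ v +ᶻ (D -ᶻ G) *ᶻ u +ᶻ G *ᶻ v →
  + p ∣ᶻ C *ᶻ u *ᶻ v
close⇒∣ p q C D G u v m ε δ k l D+G<p ε<q δ<q v-u m-u eq = divides K (begin
  C *ᶻ u *ᶻ v   ≡⟨ ℤ.i-j≡0⇒i≡j (C *ᶻ u *ᶻ v) (+ p *ᶻ K) quotient≡0 ⟩
  + p *ᶻ K      ≡⟨ ℤ.*-comm (+ p) K ⟩
  K *ᶻ + p      ∎)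
  where
  open ≡-Reasoning
  K quotient : ℤ
  K = D *ᶻ l -ᶻ G *ᶻ k
  quotient = C *ᶻ u *ᶻ v -ᶻ + p *ᶻ K
  multiple : D *ᶻ δ -ᶻ G *ᶻ ε ≡ quotient *ᶻ (+ p *ᶻ + q)
  multiple = error-multiple {C} {D} {G} {+ p} {+ q} {u} {v} {m} {ε} {δ} {k} {l} v-u m-u eq
  +p*+q : + p *ᶻ + q ≡ + (p ℕ.* q)
  +p*+q = sym (ℤ.pos-* p q)
  small : ∣ D *ᶻ δ -ᶻ G *ᶻ ε ∣ < p ℕ.* q
  small = ℕ.≤-<-trans (ℤ.∣i-j∣≤∣i∣+∣j∣ (D *ᶻ δ) (G *ᶻ ε))
    (subst (_< p ℕ.* q) (cong₂ ℕ._+_ (sym (ℤ.abs-* D δ)) (sym (ℤ.abs-* G ε)))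
      (ℕ.≤-<-trans (ℕ.+-mono-≤ (ℕ.*-monoʳ-≤ ∣ D ∣ (ℕ.<⇒≤ δ<q)) (ℕ.*-monoʳ-≤ ∣ G ∣ (ℕ.<⇒≤ ε<q)))
        (subst (_< p ℕ.* q) (ℕ.*-distribʳ-+ q ∣ D ∣ ∣ G ∣) (ℕ.*-monoˡ-< q D+G<p))))
  quotient≡0 : quotient ≡ 0ℤ
  quotient≡0 = [ (λ q≡0 → q≡0)
    , (λ pq≡0 → contradiction (ℤ.+-injective (trans (sym +p*+q) pq≡0))
        (ℕ.≢-nonZero⁻¹ _ {{ℕ.m*n≢0 p q}}))
    ]′
    (ℤ.i*j≡0⇒i≡0∨j≡0 quotient (trans (sym multiple)
      (∣∣<⇒≡0 (divides quotient (trans multiple (cong (quotient *ᶻ_) +p*+q))) small)))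

-- Valuations and units at a prime

module _ {p : ℕ} (p-prime : Prime p) where

  private instance
    p-nonZero : NonZero p
    p-nonZero = prime⇒nonZero p-prime

  -- Positivity guards only the specification, so that valuation and unit are total functions on `ℕ`
  -- and can enter a colouring; the pair at 0 is a dummy.
  decompose : ∀ n → ∃₂ λ s u → NonZero n → n ≡ p ^ s ℕ.* u × ¬ + p ∣ᶻ + u
  decompose = <-rec _ go
    where
    go : ∀ n → (∀ {m} → m < n → ∃₂ λ s u → NonZero m → m ≡ p ^ s ℕ.* u × ¬ + p ∣ᶻ + u) →
         ∃₂ λ s u → NonZero n → n ≡ p ^ s ℕ.* u × ¬ + p ∣ᶻ + u
    go zero    rec = 0 , 0 , λ ()
    go (suc n) rec with p ℕ.∣? suc n
    ... | no p∤n = 0 , suc n , λ _ → sym (ℕ.*-identityˡ (suc n)) , p∤n ∘ ∣ᶻ.∣⇒∣ᵤ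
    ... | yes (ℕ.divides m@(suc _) eq)
      with rec (subst (m <_) (sym eq) (ℕ.m<m*n m p (ℕ.nonTrivial⇒n>1 p {{prime⇒nonTrivial p-prime}})))
    ...   | s , u , spec = suc s , u , λ _ → (begin
        suc n                   ≡⟨ eq ⟩
        m ℕ.* p                 ≡⟨ ℕ.*-comm m p ⟩
        p ℕ.* m                 ≡⟨ cong (p ℕ.*_) (proj₁ (spec _)) ⟩
        p ℕ.* (p ^ s ℕ.* u)     ≡⟨ ℕ.*-assoc p (p ^ s) u ⟨
        p ^ suc s ℕ.* u         ∎) , proj₂ (spec _)
        where open ≡-Reasoning

  euclid : ∀ i j → + p ∣ᶻ i *ᶻ j → + p ∣ᶻ i ⊎ + p ∣ᶻ j
  euclid i j p∣ij = [ inj₁ ∘ ∣ᶻ.∣ᵤ⇒∣ , inj₂ ∘ ∣ᶻ.∣ᵤ⇒∣ ]′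
    (euclidsLemma ∣ i ∣ ∣ j ∣ p-prime (subst (p ℕ.∣_) (ℤ.abs-* i j) (∣ᶻ.∣⇒∣ᵤ p∣ij)))

  euclid₃ : ∀ {i j k} → ¬ + p ∣ᶻ i → ¬ + p ∣ᶻ j → ¬ + p ∣ᶻ k → ¬ + p ∣ᶻ i *ᶻ j *ᶻ k
  euclid₃ {i} {j} {k} ∤i ∤j ∤k = [ [ ∤i , ∤j ]′ ∘ euclid i j , ∤k ]′ ∘ euclid (i *ᶻ j) k

  p^ : ℕ → ℤ
  p^ s = + (p ^ s)

  p^-suc : ∀ s → p^ (suc s) ≡ + p *ᶻ p^ s
  p^-suc s = ℤ.pos-* p (p ^ s)

  p^-nonZero : ∀ s → ℤ.NonZero (p^ s)
  p^-nonZero s = ℕ.m^n≢0 p s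

  valuation-unique : ∀ a b {i j} → ¬ + p ∣ᶻ i → ¬ + p ∣ᶻ j → p^ a *ᶻ i ≡ p^ b *ᶻ j → a ≡ b
  valuation-unique zero    zero    _ _ _ = refl
  valuation-unique zero    (suc b) {i} {j} ∤i _ eq = contradiction (divides (p^ b *ᶻ j) (begin
    i                       ≡⟨ ℤ.*-identityˡ i ⟨
    1ℤ *ᶻ i                 ≡⟨ eq ⟩
    p^ (suc b) *ᶻ j         ≡⟨ cong (_*ᶻ j) (p^-suc b) ⟩
    + p *ᶻ p^ b *ᶻ j        ≡⟨ ℤ.*-assoc (+ p) (p^ b) j ⟩
    + p *ᶻ (p^ b *ᶻ j)      ≡⟨ ℤ.*-comm (+ p) _ ⟩
    p^ b *ᶻ j *ᶻ + p        ∎)) ∤i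
    where open ≡-Reasoning
  valuation-unique (suc a) zero    ∤i ∤j eq = sym (valuation-unique zero (suc a) ∤j ∤i (sym eq))
  valuation-unique (suc a) (suc b) {i} {j} ∤i ∤j eq = cong suc (valuation-unique a b ∤i ∤j
    (ℤ.*-cancelˡ-≡ (+ p) _ _ (begin
      + p *ᶻ (p^ a *ᶻ i)    ≡⟨ ℤ.*-assoc (+ p) (p^ a) i ⟨
      + p *ᶻ p^ a *ᶻ i      ≡⟨ cong (_*ᶻ i) (p^-suc a) ⟨
      p^ (suc a) *ᶻ i       ≡⟨ eq ⟩
      p^ (suc b) *ᶻ j       ≡⟨ cong (_*ᶻ j) (p^-suc b) ⟩
      + p *ᶻ p^ b *ᶻ j      ≡⟨ ℤ.*-assoc (+ p) (p^ b) j ⟩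
      + p *ᶻ (p^ b *ᶻ j)    ∎)))
    where open ≡-Reasoning

  -- If `F` is nonzero, the bounds make `D m` and `F v + p j` prime to `p`, so the valuations agree.
  -- After cancelling `p^t`, the congruence `m ≡ v` gives `(D - F) v ≡ 0` modulo `p`, and
  -- `∣ D - F ∣ < p` turns this into `D = F`.
  leading-coefficient : ∀ {D F} o t {m v j} → D ≢ 0ℤ → ∣ D ∣ < p → ∣ F ∣ < p → ∣ D -ᶻ F ∣ < p →
    ¬ + p ∣ᶻ m → ¬ + p ∣ᶻ v → + p ∣ᶻ m -ᶻ v →
    D *ᶻ (p^ o *ᶻ m) ≡ F *ᶻ (p^ t *ᶻ v) +ᶻ p^ (suc t) *ᶻ j →
    F ≡ 0ℤ ⊎ (D ≡ F × o ≡ t)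
  leading-coefficient {D} {F} o t {m} {v} {j} D≢0 D<p F<p D-F<p p∤m p∤v p∣m-v eq with F ℤ.≟ 0ℤ
  ... | yes F≡0 = inj₁ F≡0
  ... | no  F≢0 = inj₂ (ℤ.i-j≡0⇒i≡j D F (∣∣<⇒≡0 p∣D-F D-F<p) , o≡t)
    where
    open ≡-Reasoning
    p∤D : ¬ + p ∣ᶻ D
    p∤D p∣D = D≢0 (∣∣<⇒≡0 p∣D D<p)
    p∤F : ¬ + p ∣ᶻ F
    p∤F p∣F = F≢0 (∣∣<⇒≡0 p∣F F<p)
    p∤rhs : ¬ + p ∣ᶻ F *ᶻ v +ᶻ + p *ᶻ j
    p∤rhs d = [ p∤F , p∤v ]′ (euclid F v (∣ᶻ.∣m+n∣n⇒∣m d (∣ᶻ.∣m⇒∣m*n j ∣ᶻ.∣-refl)))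
    factored : p^ o *ᶻ (D *ᶻ m) ≡ p^ t *ᶻ (F *ᶻ v +ᶻ + p *ᶻ j)
    factored = begin
      p^ o *ᶻ (D *ᶻ m)                            ≡⟨ swap (p^ o) D m ⟩
      D *ᶻ (p^ o *ᶻ m)                            ≡⟨ eq ⟩
      F *ᶻ (p^ t *ᶻ v) +ᶻ p^ (suc t) *ᶻ j         ≡⟨ cong (λ P → F *ᶻ (p^ t *ᶻ v) +ᶻ P *ᶻ j) (p^-suc t) ⟩
      F *ᶻ (p^ t *ᶻ v) +ᶻ + p *ᶻ p^ t *ᶻ j        ≡⟨ factor F (p^ t) v (+ p) j ⟩
      p^ t *ᶻ (F *ᶻ v +ᶻ + p *ᶻ j)                ∎
      where
      swap : ∀ a b c → a *ᶻ (b *ᶻ c) ≡ b *ᶻ (a *ᶻ c)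
      swap = solve-∀
      factor : ∀ F P v p j → F *ᶻ (P *ᶻ v) +ᶻ p *ᶻ P *ᶻ j ≡ P *ᶻ (F *ᶻ v +ᶻ p *ᶻ j)
      factor = solve-∀
    o≡t : o ≡ t
    o≡t = valuation-unique o t ([ p∤D , p∤m ]′ ∘ euclid D m) p∤rhs factored
    units : D *ᶻ m ≡ F *ᶻ v +ᶻ + p *ᶻ j
    units = ℤ.*-cancelˡ-≡ (p^ t) _ _ {{p^-nonZero t}}
      (trans (cong (λ k → p^ k *ᶻ (D *ᶻ m)) (sym o≡t)) factored)
    p∣D-F : + p ∣ᶻ D -ᶻ F
    p∣D-F = [ (λ d → d) , (λ d → contradiction d p∤v) ]′ (euclid (D -ᶻ F) v
      (subst (+ p ∣ᶻ_) (rearrange D F m v)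
        (∣ᶻ.∣m∣n⇒∣m-n (subst (λ e → + p ∣ᶻ e -ᶻ F *ᶻ v) (sym units)
                          (subst (+ p ∣ᶻ_) (sym (drop (F *ᶻ v) (+ p *ᶻ j))) (∣ᶻ.∣m⇒∣m*n j ∣ᶻ.∣-refl)))
                        (∣ᶻ.∣n⇒∣m*n D p∣m-v))))
      where
      drop : ∀ a b → (a +ᶻ b) -ᶻ a ≡ b
      drop = solve-∀
      rearrange : ∀ D F m v → (D *ᶻ m -ᶻ F *ᶻ v) -ᶻ D *ᶻ (m -ᶻ v) ≡ (D -ᶻ F) *ᶻ v
      rearrange = solve-∀

  -- The units `u`, `v`, `m` belong to numbers of common valuation `suc s`, and the equation is the
  -- original one for `E = D - G` after division by `p ^ suc s`. Thus `p ^ s` is the place value of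
  -- the lower of the two digits.
  no-close-units : ∀ {D C G} s u v m → ∣ D ∣ ℕ.+ ∣ G ∣ < p → ¬ + p ∣ᶻ C → ¬ + p ∣ᶻ + u → ¬ + p ∣ᶻ + v →
    let instance q≢0 = ℕ.m^n≢0 p s
                 N≢0 = ℕ.m*n≢0 p p
        digits = λ n → (n ℕ./ (p ^ s)) ℕ.mod (p ℕ.* p)
    in digits u ≡ digits v → digits u ≡ digits m →
    D *ᶻ + m ≡ C *ᶻ p^ (suc s) *ᶻ + u *ᶻ + v +ᶻ (D -ᶻ G) *ᶻ + u +ᶻ G *ᶻ + v → ⊥
  no-close-units {D} {C} {G} s u v m D+G<p p∤C p∤u p∤v duv dum eq =
    euclid₃ {C} {+ u} {+ v} p∤C p∤u p∤v
      (close⇒∣ p (p ^ s) {{p-nonZero}} {{ℕ.m^n≢0 p s}} C D G (+ u) (+ v) (+ m)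
        (proj₁ near-v) (proj₁ near-m) (proj₁ (proj₂ near-v)) (proj₁ (proj₂ near-m))
        D+G<p (proj₂ (proj₂ (proj₂ near-v))) (proj₂ (proj₂ (proj₂ near-m)))
        (proj₁ (proj₂ (proj₂ near-v))) (proj₁ (proj₂ (proj₂ near-m)))
        (subst (λ P → D *ᶻ + m ≡ C *ᶻ P *ᶻ + u *ᶻ + v +ᶻ (D -ᶻ G) *ᶻ + u +ᶻ G *ᶻ + v) (p^-suc s) eq))
    where
    near : ∀ w → ((u ℕ./ (p ^ s)) {{ℕ.m^n≢0 p s}} ℕ.mod (p ℕ.* p)) {{ℕ.m*n≢0 p p}} ≡
                 ((w ℕ./ (p ^ s)) {{ℕ.m^n≢0 p s}} ℕ.mod (p ℕ.* p)) {{ℕ.m*n≢0 p p}} →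
      ∃₂ λ ε k → + w -ᶻ + u ≡ ε +ᶻ k *ᶻ (p^ s *ᶻ (+ p *ᶻ + p)) × ∣ ε ∣ < p ^ s
    near w eq = subst (λ N → ∃₂ λ ε k → + w -ᶻ + u ≡ ε +ᶻ k *ᶻ (p^ s *ᶻ N) × ∣ ε ∣ < p ^ s) (ℤ.pos-* p p)
      (same-digits⇒close u w (p ^ s) (p ℕ.* p) {{ℕ.m^n≢0 p s}} {{ℕ.m*n≢0 p p}} eq)
    near-v = near v duv
    near-m = near m dum

-- One equation without constant term under the digit colouring

-- Read `P` and `Q` as the powers of `p` in `x` and `y`. Since `p` divides `Q`, the product is
-- negligible modulo `p P`, and the second hypothesis makes the term in `y` negligible as well; only
-- `E` remains visible.
absorb-product : ∀ {D C E G P Q p T u v m j : ℤ} → Q ≡ p *ᶻ T → G *ᶻ Q ≡ p *ᶻ P *ᶻ j →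
  D *ᶻ m ≡ C *ᶻ (P *ᶻ u) *ᶻ (Q *ᶻ v) +ᶻ E *ᶻ (P *ᶻ u) +ᶻ G *ᶻ (Q *ᶻ v) →
  D *ᶻ m ≡ E *ᶻ (P *ᶻ u) +ᶻ p *ᶻ P *ᶻ (C *ᶻ u *ᶻ T *ᶻ v +ᶻ j *ᶻ v)
absorb-product {D} {C} {E} {G} {P} {Q} {p} {T} {u} {v} {m} {j} Q≡pT GQ≡ eq = begin
  D *ᶻ m
    ≡⟨ eq ⟩
  C *ᶻ (P *ᶻ u) *ᶻ (Q *ᶻ v) +ᶻ E *ᶻ (P *ᶻ u) +ᶻ G *ᶻ (Q *ᶻ v)
    ≡⟨ cong (C *ᶻ (P *ᶻ u) *ᶻ (Q *ᶻ v) +ᶻ E *ᶻ (P *ᶻ u) +ᶻ_) (ℤ.*-assoc G Q v) ⟨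
  C *ᶻ (P *ᶻ u) *ᶻ (Q *ᶻ v) +ᶻ E *ᶻ (P *ᶻ u) +ᶻ G *ᶻ Q *ᶻ v
    ≡⟨ cong₂ (λ a b → C *ᶻ (P *ᶻ u) *ᶻ (a *ᶻ v) +ᶻ E *ᶻ (P *ᶻ u) +ᶻ b *ᶻ v) Q≡pT GQ≡ ⟩
  C *ᶻ (P *ᶻ u) *ᶻ (p *ᶻ T *ᶻ v) +ᶻ E *ᶻ (P *ᶻ u) +ᶻ p *ᶻ P *ᶻ j *ᶻ v
    ≡⟨ rearrange C E P p T u v j ⟩
  E *ᶻ (P *ᶻ u) +ᶻ p *ᶻ P *ᶻ (C *ᶻ u *ᶻ T *ᶻ v +ᶻ j *ᶻ v) ∎
  where
  open ≡-Reasoning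
  rearrange : ∀ C E P p T u v j → C *ᶻ (P *ᶻ u) *ᶻ (p *ᶻ T *ᶻ v) +ᶻ E *ᶻ (P *ᶻ u) +ᶻ p *ᶻ P *ᶻ j *ᶻ v ≡
    E *ᶻ (P *ᶻ u) +ᶻ p *ᶻ P *ᶻ (C *ᶻ u *ᶻ T *ᶻ v +ᶻ j *ᶻ v)
  rearrange = solve-∀

-- Because `v ≡ u` modulo `p`, replacing `v` by `u` in the linear part costs a multiple of `p P`.
-- The product is such a multiple since `p` divides one of its two factors `P`.
merge-linear-terms : ∀ {D C E G P p T u v m k : ℤ} → P ≡ p *ᶻ T → v -ᶻ u ≡ k *ᶻ p →
  D *ᶻ m ≡ C *ᶻ (P *ᶻ u) *ᶻ (P *ᶻ v) +ᶻ E *ᶻ (P *ᶻ u) +ᶻ G *ᶻ (P *ᶻ v) →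
  D *ᶻ m ≡ (E +ᶻ G) *ᶻ (P *ᶻ u) +ᶻ p *ᶻ P *ᶻ (C *ᶻ u *ᶻ T *ᶻ v +ᶻ G *ᶻ k)
merge-linear-terms {D} {C} {E} {G} {P} {p} {T} {u} {v} {m} {k} P≡pT v-u≡kp eq = begin
  D *ᶻ m
    ≡⟨ eq ⟩
  C *ᶻ (P *ᶻ u) *ᶻ (P *ᶻ v) +ᶻ E *ᶻ (P *ᶻ u) +ᶻ G *ᶻ (P *ᶻ v)
    ≡⟨ split C E G P u v ⟩
  C *ᶻ u *ᶻ v *ᶻ P *ᶻ P +ᶻ (E +ᶻ G) *ᶻ (P *ᶻ u) +ᶻ G *ᶻ P *ᶻ (v -ᶻ u)
    ≡⟨ cong₂ (λ a b → C *ᶻ u *ᶻ v *ᶻ P *ᶻ a +ᶻ (E +ᶻ G) *ᶻ (P *ᶻ u) +ᶻ G *ᶻ P *ᶻ b) P≡pT v-u≡kp ⟩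
  C *ᶻ u *ᶻ v *ᶻ P *ᶻ (p *ᶻ T) +ᶻ (E +ᶻ G) *ᶻ (P *ᶻ u) +ᶻ G *ᶻ P *ᶻ (k *ᶻ p)
    ≡⟨ rearrange C (E +ᶻ G) G P p T u v k ⟩
  (E +ᶻ G) *ᶻ (P *ᶻ u) +ᶻ p *ᶻ P *ᶻ (C *ᶻ u *ᶻ T *ᶻ v +ᶻ G *ᶻ k) ∎
  where
  open ≡-Reasoning
  split : ∀ C E G P u v → C *ᶻ (P *ᶻ u) *ᶻ (P *ᶻ v) +ᶻ E *ᶻ (P *ᶻ u) +ᶻ G *ᶻ (P *ᶻ v) ≡
    C *ᶻ u *ᶻ v *ᶻ P *ᶻ P +ᶻ (E +ᶻ G) *ᶻ (P *ᶻ u) +ᶻ G *ᶻ P *ᶻ (v -ᶻ u)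
  split = solve-∀
  rearrange : ∀ C F G P p T u v k →
    C *ᶻ u *ᶻ v *ᶻ P *ᶻ (p *ᶻ T) +ᶻ F *ᶻ (P *ᶻ u) +ᶻ G *ᶻ P *ᶻ (k *ᶻ p) ≡
    F *ᶻ (P *ᶻ u) +ᶻ p *ᶻ P *ᶻ (C *ᶻ u *ᶻ T *ᶻ v +ᶻ G *ᶻ k)
  rearrange = solve-∀

swap-variables : ∀ {C E G x y c : ℤ} → c ≡ C *ᶻ x *ᶻ y +ᶻ E *ᶻ x +ᶻ G *ᶻ y → c ≡ C *ᶻ y *ᶻ x +ᶻ G *ᶻ y +ᶻ E *ᶻ x
swap-variables {C} {E} {G} {x} {y} eq = trans eq (swap C E G x y)
  where
  swap : ∀ C E G x y → C *ᶻ x *ᶻ y +ᶻ E *ᶻ x +ᶻ G *ᶻ y ≡ C *ᶻ y *ᶻ x +ᶻ G *ᶻ y +ᶻ E *ᶻ x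
  swap = solve-∀

module _ {p : ℕ} (p-prime : Prime p) where

  private instance
    p-nonZero : NonZero p
    p-nonZero = prime⇒nonZero p-prime

  private
    P : ℕ → ℤ
    P = p^ p-prime

  -- For a number of valuation `s` and unit `u`, these are the digits of `u` in the places `s - 1`
  -- and `s`. The truncation of `pred` at 0 is harmless: the digits are exploited only at positive
  -- valuations.
  digits : ℕ → ℕ → Fin (p ℕ.* p)
  digits s u = ((u ℕ./ (p ^ ℕ.pred s)) {{ℕ.m^n≢0 p (ℕ.pred s)}} ℕ.mod (p ℕ.* p)) {{ℕ.m*n≢0 p p}}

  shade : ℕ → Fin (p ℕ.* (p ℕ.* p))
  shade n = Fin.combine (u ℕ.mod p) (digits s u)
    where
    s = proj₁ (decompose p-prime n)
    u = proj₁ (proj₂ (decompose p-prime n))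

  -- The hypothesis on `G` unites the two ways in which the term in `y` can be neglected modulo
  -- `p^(s+1)`: either `G` is zero, or `y` has the larger valuation.
  linear-coefficient : ∀ {D C E G} s t o {u v m : ℕ} {j} → D ≢ 0ℤ → ∣ D ∣ ℕ.+ ∣ E ∣ < p →
    ¬ + p ∣ᶻ + m → ¬ + p ∣ᶻ + u → + p ∣ᶻ + m -ᶻ + u →
    G *ᶻ P (suc t) ≡ + p *ᶻ P s *ᶻ j →
    D *ᶻ (P o *ᶻ + m) ≡ C *ᶻ (P s *ᶻ + u) *ᶻ (P (suc t) *ᶻ + v) +ᶻ E *ᶻ (P s *ᶻ + u) +ᶻ G *ᶻ (P (suc t) *ᶻ + v) →
    E ≡ 0ℤ ⊎ E ≡ D
  linear-coefficient {D} {C} {E} {G} s t o {u} {v} {m} {j} D≢0 D+E<p p∤m p∤u p∣m-u G-multiple eq =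
    map₂ (sym ∘ proj₁) (leading-coefficient p-prime {D} {E} o s {+ m} {+ u} {w} D≢0
      (ℕ.≤-<-trans (ℕ.m≤m+n ∣ D ∣ ∣ E ∣) D+E<p)
      (ℕ.≤-<-trans (ℕ.m≤n+m ∣ E ∣ ∣ D ∣) D+E<p)
      (ℕ.≤-<-trans (ℤ.∣i-j∣≤∣i∣+∣j∣ D E) D+E<p)
      p∤m p∤u p∣m-u
      (subst (λ Q → D *ᶻ (P o *ᶻ + m) ≡ E *ᶻ (P s *ᶻ + u) +ᶻ Q *ᶻ w)
        (sym (p^-suc p-prime s))
        (absorb-product {D} {C} {E} {G} {P s} {P (suc t)} {+ p} {P t} {+ u} {+ v} {P o *ᶻ + m} {j}
          (p^-suc p-prime t) G-multiple eq)))
    where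
    w = C *ᶻ + u *ᶻ P t *ᶻ + v +ᶻ j *ᶻ + v

  -- What `leading-coefficient` leaves besides `E + G = 0` is `E + G = D` together with `o = suc s`,
  -- and `no-close-units` refutes it. The digits of `m` are read at places given by its own
  -- valuation `o`, so they are comparable with those of `u` only once `o = suc s` is known.
  equal-valuations : ∀ {D C E G} s o {u v m : ℕ} → D ≢ 0ℤ → C ≢ 0ℤ →
    ∣ D ∣ ℕ.+ ∣ C ∣ ℕ.+ (∣ E ∣ ℕ.+ ∣ G ∣) < p →
    ¬ + p ∣ᶻ + u → ¬ + p ∣ᶻ + v → ¬ + p ∣ᶻ + m → + p ∣ᶻ + v -ᶻ + u → + p ∣ᶻ + m -ᶻ + u →
    digits (suc s) u ≡ digits (suc s) v → (o ≡ suc s → digits (suc s) u ≡ digits (suc s) m) →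
    D *ᶻ (P o *ᶻ + m) ≡
      C *ᶻ (P (suc s) *ᶻ + u) *ᶻ (P (suc s) *ᶻ + v) +ᶻ E *ᶻ (P (suc s) *ᶻ + u) +ᶻ G *ᶻ (P (suc s) *ᶻ + v) →
    E +ᶻ G ≡ 0ℤ
  equal-valuations {D} {C} {E} {G} s o {u} {v} {m} D≢0 C≢0 bound p∤u p∤v p∤m (divides k v-u) p∣m-u duv dum eq =
    [ (λ E+G≡0 → E+G≡0) , (λ h → ⊥-elim (impossible (proj₁ h) (proj₂ h))) ]′
      (leading-coefficient p-prime {D} {E +ᶻ G} o (suc s) {+ m} {+ u} {w} D≢0
           D<p EG<p D-EG<p p∤m p∤u p∣m-u
           (subst (λ Q → D *ᶻ (P o *ᶻ + m) ≡ (E +ᶻ G) *ᶻ (P (suc s) *ᶻ + u) +ᶻ Q *ᶻ w)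
             (sym (p^-suc p-prime (suc s)))
             (merge-linear-terms {D} {C} {E} {G} {P (suc s)} {+ p} {P s} {+ u} {+ v} {P o *ᶻ + m} {k}
               (p^-suc p-prime s) v-u eq)))
    where
    w = C *ᶻ + u *ᶻ P s *ᶻ + v +ᶻ G *ᶻ k
    D<p : ∣ D ∣ < p
    D<p = ℕ.≤-<-trans (ℕ.≤-trans (ℕ.m≤m+n ∣ D ∣ ∣ C ∣) (ℕ.m≤m+n (∣ D ∣ ℕ.+ ∣ C ∣) (∣ E ∣ ℕ.+ ∣ G ∣))) bound
    EG<p : ∣ E +ᶻ G ∣ < p
    EG<p = ℕ.≤-<-trans (ℕ.≤-trans (ℤ.∣i+j∣≤∣i∣+∣j∣ E G) (ℕ.m≤n+m (∣ E ∣ ℕ.+ ∣ G ∣) (∣ D ∣ ℕ.+ ∣ C ∣))) bound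
    D-EG<p : ∣ D -ᶻ (E +ᶻ G) ∣ < p
    D-EG<p = ℕ.≤-<-trans (ℕ.≤-trans (ℤ.∣i-j∣≤∣i∣+∣j∣ D (E +ᶻ G))
      (ℕ.+-mono-≤ (ℕ.m≤m+n ∣ D ∣ ∣ C ∣) (ℤ.∣i+j∣≤∣i∣+∣j∣ E G))) bound
    p∤C : ¬ + p ∣ᶻ C
    p∤C p∣C = C≢0 (∣∣<⇒≡0 p∣C (
      ℕ.≤-<-trans (ℕ.≤-trans (ℕ.m≤n+m ∣ C ∣ ∣ D ∣) (ℕ.m≤m+n (∣ D ∣ ℕ.+ ∣ C ∣) (∣ E ∣ ℕ.+ ∣ G ∣))) bound))
    E≡D-G : D ≡ E +ᶻ G → E ≡ D -ᶻ G
    E≡D-G D≡E+G = trans (shuffle E G) (cong (_-ᶻ G) (sym D≡E+G))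
      where
      shuffle : ∀ E G → E ≡ (E +ᶻ G) -ᶻ G
      shuffle = solve-∀
    cancelled : D ≡ E +ᶻ G → o ≡ suc s → D *ᶻ + m ≡ C *ᶻ P (suc s) *ᶻ + u *ᶻ + v +ᶻ (D -ᶻ G) *ᶻ + u +ᶻ G *ᶻ + v
    cancelled D≡E+G o≡ =
      ℤ.*-cancelˡ-≡ (P (suc s)) (D *ᶻ + m) (C *ᶻ P (suc s) *ᶻ + u *ᶻ + v +ᶻ (D -ᶻ G) *ᶻ + u +ᶻ G *ᶻ + v)
      {{p^-nonZero p-prime (suc s)}} (begin
      P (suc s) *ᶻ (D *ᶻ + m)
        ≡⟨ left D (P (suc s)) (+ m) ⟩
      D *ᶻ (P (suc s) *ᶻ + m)
        ≡⟨ cong (λ n → D *ᶻ (P n *ᶻ + m)) (sym o≡) ⟩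
      D *ᶻ (P o *ᶻ + m)
        ≡⟨ eq ⟩
      C *ᶻ (P (suc s) *ᶻ + u) *ᶻ (P (suc s) *ᶻ + v) +ᶻ E *ᶻ (P (suc s) *ᶻ + u) +ᶻ G *ᶻ (P (suc s) *ᶻ + v)
        ≡⟨ right C E G (P (suc s)) (+ u) (+ v) ⟩
      P (suc s) *ᶻ (C *ᶻ P (suc s) *ᶻ + u *ᶻ + v +ᶻ E *ᶻ + u +ᶻ G *ᶻ + v)
        ≡⟨ cong (λ F → P (suc s) *ᶻ (C *ᶻ P (suc s) *ᶻ + u *ᶻ + v +ᶻ F *ᶻ + u +ᶻ G *ᶻ + v)) (E≡D-G D≡E+G) ⟩
      P (suc s) *ᶻ (C *ᶻ P (suc s) *ᶻ + u *ᶻ + v +ᶻ (D -ᶻ G) *ᶻ + u +ᶻ G *ᶻ + v) ∎)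
      where
      open ≡-Reasoning
      left : ∀ D P m → P *ᶻ (D *ᶻ m) ≡ D *ᶻ (P *ᶻ m)
      left = solve-∀
      right : ∀ C E G P u v → C *ᶻ (P *ᶻ u) *ᶻ (P *ᶻ v) +ᶻ E *ᶻ (P *ᶻ u) +ᶻ G *ᶻ (P *ᶻ v) ≡
        P *ᶻ (C *ᶻ P *ᶻ u *ᶻ v +ᶻ E *ᶻ u +ᶻ G *ᶻ v)
      right = solve-∀
    impossible : D ≡ E +ᶻ G → o ≡ suc s → ⊥
    impossible D≡E+G o≡ = no-close-units p-prime {D} {C} {G} s u v m
      (ℕ.≤-<-trans (ℕ.+-mono-≤ (ℕ.m≤m+n ∣ D ∣ ∣ C ∣) (ℕ.m≤n+m ∣ G ∣ ∣ E ∣)) bound)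
      p∤C p∤u p∤v duv (dum o≡) (cancelled D≡E+G o≡)

  valuation : ℕ → ℕ
  valuation n = proj₁ (decompose p-prime n)

  unit : ℕ → ℕ
  unit n = proj₁ (proj₂ (decompose p-prime n))

  power-multiple : ∀ {s t} G → s < t → ∃ λ j → G *ᶻ P t ≡ + p *ᶻ P s *ᶻ j
  power-multiple {s} G s<t = go (ℕ.m≤n⇒∃[o]m+o≡n s<t)
    where
    go : ∀ {t} → ∃ (λ d → suc s ℕ.+ d ≡ t) → ∃ λ j → G *ᶻ P t ≡ + p *ᶻ P s *ᶻ j
    go (d , refl) = G *ᶻ + (p ^ d) , (begin
      G *ᶻ P (suc s ℕ.+ d)                  ≡⟨ cong (λ n → G *ᶻ + n) (ℕ.^-distribˡ-+-* p (suc s) d) ⟩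
      G *ᶻ + (p ^ suc s ℕ.* p ^ d)          ≡⟨ cong (G *ᶻ_) (ℤ.pos-* (p ^ suc s) (p ^ d)) ⟩
      G *ᶻ (P (suc s) *ᶻ + (p ^ d))         ≡⟨ cong (λ Q → G *ᶻ (Q *ᶻ + (p ^ d))) (p^-suc p-prime s) ⟩
      G *ᶻ (+ p *ᶻ P s *ᶻ + (p ^ d))        ≡⟨ shuffle G (+ p *ᶻ P s) (+ (p ^ d)) ⟩
      + p *ᶻ P s *ᶻ (G *ᶻ + (p ^ d))        ∎)
      where
      open ≡-Reasoning
      shuffle : ∀ a b c → a *ᶻ (b *ᶻ c) ≡ b *ᶻ (a *ᶻ c)
      shuffle = solve-∀

  shade-≡⇒unit : ∀ {x y} → shade x ≡ shade y → + p ∣ᶻ + unit y -ᶻ + unit x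
  shade-≡⇒unit {x} {y} eq = mod-≡⇒∣ (unit y) (unit x) p
    (sym (Fin.combine-injectiveˡ (unit x ℕ.mod p) (digits (valuation x) (unit x))
      (unit y ℕ.mod p) (digits (valuation y) (unit y)) eq))

  shade-≡⇒digits : ∀ {x y} → shade x ≡ shade y → digits (valuation x) (unit x) ≡ digits (valuation y) (unit y)
  shade-≡⇒digits {x} {y} eq =
    Fin.combine-injectiveʳ (unit x ℕ.mod p) (digits (valuation x) (unit x))
      (unit y ℕ.mod p) (digits (valuation y) (unit y)) eq

  -- The alternative `G ≡ 0ℤ` asks nothing of the valuations. It is needed when `E G = 0`, where the
  -- order of `s` and `t` may be the wrong one.
  Restricted : (D E G : ℤ) (s t : ℕ) → Set
  Restricted D E G s t =
    (G ≡ 0ℤ ⊎ s < t → E ≡ 0ℤ ⊎ E ≡ D) × (s ≡ t → E +ᶻ G ≡ 0ℤ)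

  restricted : ∀ {D C E G} x y z .{{_ : NonZero x}} .{{_ : NonZero y}} .{{_ : NonZero z}} → D ≢ 0ℤ → C ≢ 0ℤ →
    ∣ D ∣ ℕ.+ ∣ C ∣ ℕ.+ (∣ E ∣ ℕ.+ ∣ G ∣) < p →
    + p ∣ᶻ + y → shade x ≡ shade y → shade x ≡ shade z →
    D *ᶻ + z ≡ C *ᶻ + x *ᶻ + y +ᶻ E *ᶻ + x +ᶻ G *ᶻ + y →
    Restricted D E G (valuation x) (valuation y)
  restricted {D} {C} {E} {G} x y z D≢0 C≢0 bound p∣y xy xz eq =
    -- Valuations and units become variables here, so that the valuation of `y` can be split into
    -- zero and successor and equalities of valuations can be matched with `refl`.
    go (valuation x) (valuation y) (valuation z) {unit x} {unit y} {unit z}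
      (proj₂ (proj₂ (decompose p-prime x)) it) (proj₂ (proj₂ (decompose p-prime y)) it)
      (proj₂ (proj₂ (decompose p-prime z)) it)
      (shade-≡⇒unit {x} {y} xy) (shade-≡⇒unit {x} {z} xz) (shade-≡⇒digits {x} {y} xy) (shade-≡⇒digits {x} {z} xz)
    where
    it : ∀ {n} .{{_ : NonZero n}} → NonZero n
    it {suc n} = _
    go : ∀ s t o {u v m} → x ≡ p ^ s ℕ.* u × ¬ + p ∣ᶻ + u →
      y ≡ p ^ t ℕ.* v × ¬ + p ∣ᶻ + v → z ≡ p ^ o ℕ.* m × ¬ + p ∣ᶻ + m →
      + p ∣ᶻ + v -ᶻ + u → + p ∣ᶻ + m -ᶻ + u → digits s u ≡ digits t v → digits s u ≡ digits o m → Restricted D E G s t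
    go s zero o {v = v} _ (y≡ , p∤v) _ _ _ _ _ =
      contradiction (subst (λ n → + p ∣ᶻ + n) (trans y≡ (ℕ.*-identityˡ v)) p∣y) p∤v
    go s (suc t) o {u} {v} {m} (x≡ , p∤u) (y≡ , p∤v) (z≡ , p∤m) p∣v-u p∣m-u duv dum =
      (λ { (inj₁ G≡0) → lin 0ℤ (trans (cong (_*ᶻ P (suc t)) G≡0) (sym (ℤ.*-zeroʳ (+ p *ᶻ P s))))
         ; (inj₂ s<t) → lin (proj₁ (power-multiple G s<t)) (proj₂ (power-multiple G s<t)) }) ,
      (λ { refl → equal-valuations {D} {C} {E} {G} t o {u} {v} {m} D≢0 C≢0 bound p∤u p∤v p∤m p∣v-u p∣m-u duv
                    (λ { refl → dum }) eq′ })
      where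
      pos : ∀ n s u → n ≡ p ^ s ℕ.* u → + n ≡ P s *ᶻ + u
      pos n s u refl = ℤ.pos-* (p ^ s) u
      eq′ : D *ᶻ (P o *ᶻ + m) ≡
        C *ᶻ (P s *ᶻ + u) *ᶻ (P (suc t) *ᶻ + v) +ᶻ E *ᶻ (P s *ᶻ + u) +ᶻ G *ᶻ (P (suc t) *ᶻ + v)
      eq′ = trans (cong (D *ᶻ_) (sym (pos z o m z≡))) (trans eq
        (cong₂ (λ a b → C *ᶻ a *ᶻ b +ᶻ E *ᶻ a +ᶻ G *ᶻ b) (pos x s u x≡) (pos y (suc t) v y≡)))
      lin : ∀ j → G *ᶻ P (suc t) ≡ + p *ᶻ P s *ᶻ j → E ≡ 0ℤ ⊎ E ≡ D
      lin j G-multiple = linear-coefficient {D} {C} {E} {G} s t o {u} {v} {m} {j} D≢0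
        (ℕ.≤-<-trans (ℕ.+-mono-≤ (ℕ.m≤m+n ∣ D ∣ ∣ C ∣) (ℕ.m≤m+n ∣ E ∣ ∣ G ∣)) bound)
        p∤m p∤u p∣m-u G-multiple eq′

-- Comparing the coefficients of two equations

ShiftedOutcome : (D E₁ G₁ E₂ G₂ : ℤ) → Set
ShiftedOutcome D E₁ G₁ E₂ G₂ =
    (E₁ ≡ E₂ × G₁ ≡ G₂)
  ⊎ (E₁ ≡ G₂ × G₁ ≡ E₂)
  ⊎ ((E₁ ≡ 0ℤ × G₁ ≡ 0ℤ) × ((E₂ ≡ D × G₂ ≡ 0ℤ) ⊎ (E₂ ≡ 0ℤ × G₂ ≡ D)))
  ⊎ ((E₂ ≡ 0ℤ × G₂ ≡ 0ℤ) × ((E₁ ≡ D × G₁ ≡ 0ℤ) ⊎ (E₁ ≡ 0ℤ × G₁ ≡ D)))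

square-≡ : ∀ i j → i *ᶻ i ≡ j *ᶻ j → i ≡ j ⊎ i ≡ -ᶻ j
square-≡ i j eq = map₁ (ℤ.i-j≡0⇒i≡j i j) (map₂ (λ h → ℤ.i-j≡0⇒i≡j i (-ᶻ j) (trans (neg i j) h))
  (ℤ.i*j≡0⇒i≡0∨j≡0 (i -ᶻ j) (trans (difference i j) (ℤ.i≡j⇒i-j≡0 eq))))
  where
  neg : ∀ i j → i -ᶻ (-ᶻ j) ≡ i +ᶻ j
  neg = solve-∀
  difference : ∀ i j → (i -ᶻ j) *ᶻ (i +ᶻ j) ≡ i *ᶻ i -ᶻ j *ᶻ j
  difference = solve-∀

sum≡0⇒≡- : ∀ i j → i +ᶻ j ≡ 0ℤ → j ≡ -ᶻ i
sum≡0⇒≡- i j eq = trans (shuffle i j) (trans (cong (_-ᶻ i) eq) (ℤ.+-identityˡ (-ᶻ i)))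
  where
  shuffle : ∀ i j → j ≡ (i +ᶻ j) -ᶻ i
  shuffle = solve-∀

-- `Restricted` for both orders of the variables; its clause for `s ≡ t` is symmetric and appears
-- once.
Admissible : (D E G : ℤ) (s t : ℕ) → Set
Admissible D E G s t =
  (G ≡ 0ℤ ⊎ s < t → E ≡ 0ℤ ⊎ E ≡ D) × (E ≡ 0ℤ ⊎ t < s → G ≡ 0ℤ ⊎ G ≡ D) × (s ≡ t → E +ᶻ G ≡ 0ℤ)

module _ {D E₁ G₁ E₂ G₂ : ℤ} {s t : ℕ} (D≢0 : D ≢ 0ℤ)
  (adm₁ : Admissible D E₁ G₁ s t) (adm₂ : Admissible D E₂ G₂ s t) (product : E₁ *ᶻ G₁ ≡ E₂ *ᶻ G₂) where

  private
    Degenerate : (E G : ℤ) → Set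
    Degenerate E G = (E ≡ 0ℤ × G ≡ 0ℤ) ⊎ (E ≡ D × G ≡ 0ℤ) ⊎ (E ≡ 0ℤ × G ≡ D)

    degenerate : ∀ {E G} → Admissible D E G s t → E *ᶻ G ≡ 0ℤ → Degenerate E G
    degenerate {E} {G} (e , g , _) EG≡0 =
      [ (λ E≡0 → [ (λ G≡0 → inj₁ (E≡0 , G≡0)) , (λ G≡D → inj₂ (inj₂ (E≡0 , G≡D))) ]′ (g (inj₁ E≡0)))
      , (λ G≡0 → [ (λ E≡0 → inj₁ (E≡0 , G≡0)) , (λ E≡D → inj₂ (inj₁ (E≡D , G≡0))) ]′ (e (inj₁ G≡0)))
      ]′ (ℤ.i*j≡0⇒i≡0∨j≡0 E EG≡0)

    combine-degenerate : Degenerate E₁ G₁ → Degenerate E₂ G₂ → ShiftedOutcome D E₁ G₁ E₂ G₂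
    combine-degenerate (inj₁ (a , b)) (inj₁ (c , d)) = inj₁ (trans a (sym c) , trans b (sym d))
    combine-degenerate (inj₁ o) (inj₂ e) = inj₂ (inj₂ (inj₁ (o , e)))
    combine-degenerate (inj₂ e) (inj₁ o) = inj₂ (inj₂ (inj₂ (o , e)))
    combine-degenerate (inj₂ (inj₁ (a , b))) (inj₂ (inj₁ (c , d))) = inj₁ (trans a (sym c) , trans b (sym d))
    combine-degenerate (inj₂ (inj₁ (a , b))) (inj₂ (inj₂ (c , d))) = inj₂ (inj₁ (trans a (sym d) , trans b (sym c)))
    combine-degenerate (inj₂ (inj₂ (a , b))) (inj₂ (inj₁ (c , d))) = inj₂ (inj₁ (trans a (sym d) , trans b (sym c)))
    combine-degenerate (inj₂ (inj₂ (a , b))) (inj₂ (inj₂ (c , d))) = inj₁ (trans a (sym c) , trans b (sym d))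

    exclude : ∀ {E G} → E *ᶻ G ≢ 0ℤ → E ≡ 0ℤ ⊎ E ≡ D → E ≡ D
    exclude {E} {G} EG≢0 = [ (λ E≡0 → contradiction (cong (_*ᶻ G) E≡0) EG≢0) , (λ E≡D → E≡D) ]′

    excludeʳ : ∀ {E G} → E *ᶻ G ≢ 0ℤ → G ≡ 0ℤ ⊎ G ≡ D → G ≡ D
    excludeʳ {E} {G} EG≢0 = exclude {G} {E} (λ GE≡0 → EG≢0 (trans (ℤ.*-comm E G) GE≡0))

    negated-square : ∀ {E G} → G ≡ -ᶻ E → E *ᶻ G ≡ -ᶻ (E *ᶻ E)
    negated-square {E} G≡-E = trans (cong (E *ᶻ_) G≡-E) (sym (ℤ.neg-distribʳ-* E E))

    -- For unequal valuations, the coefficient at the smaller one is nonzero, hence `D`, in both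
    -- equations, and the common product determines the other. For equal valuations `G` is `- E`, so
    -- the product fixes `E` up to sign, and changing the sign exchanges `E` and `G`.
    nondegenerate : E₁ *ᶻ G₁ ≢ 0ℤ → ShiftedOutcome D E₁ G₁ E₂ G₂
    nondegenerate EG₁≢0 = cases (ℕ.<-cmp s t)
      where
      EG₂≢0 : E₂ *ᶻ G₂ ≢ 0ℤ
      EG₂≢0 EG₂≡0 = EG₁≢0 (trans product EG₂≡0)
      cases : Tri (s < t) (s ≡ t) (t < s) → ShiftedOutcome D E₁ G₁ E₂ G₂
      cases (tri< s<t _ _) = inj₁ (trans E₁≡D (sym E₂≡D) ,
        ℤ.*-cancelˡ-≡ D G₁ G₂ {{ℤ.≢-nonZero D≢0}}
          (trans (cong (_*ᶻ G₁) (sym E₁≡D)) (trans product (cong (_*ᶻ G₂) E₂≡D))))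
        where
        E₁≡D = exclude {E₁} {G₁} EG₁≢0 (proj₁ adm₁ (inj₂ s<t))
        E₂≡D = exclude {E₂} {G₂} EG₂≢0 (proj₁ adm₂ (inj₂ s<t))
      cases (tri> _ _ t<s) = inj₁ (
        ℤ.*-cancelʳ-≡ E₁ E₂ D {{ℤ.≢-nonZero D≢0}}
          (trans (cong (E₁ *ᶻ_) (sym G₁≡D)) (trans product (cong (E₂ *ᶻ_) G₂≡D))) ,
        trans G₁≡D (sym G₂≡D))
        where
        G₁≡D = excludeʳ {E₁} {G₁} EG₁≢0 (proj₁ (proj₂ adm₁) (inj₂ t<s))
        G₂≡D = excludeʳ {E₂} {G₂} EG₂≢0 (proj₁ (proj₂ adm₂) (inj₂ t<s))
      cases (tri≈ _ s≡t _) =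
        [ (λ E₁≡E₂ → inj₁ (E₁≡E₂ , trans G₁≡ (trans (cong -ᶻ_ E₁≡E₂) (sym G₂≡))))
        , (λ E₁≡-E₂ → inj₂ (inj₁ (trans E₁≡-E₂ (sym G₂≡) ,
             trans G₁≡ (trans (cong -ᶻ_ E₁≡-E₂) (ℤ.neg-involutive E₂)))))
        ]′ (square-≡ E₁ E₂ (ℤ.neg-injective
          (trans (sym (negated-square {E₁} G₁≡)) (trans product (negated-square {E₂} G₂≡)))))
        where
        G₁≡ = sum≡0⇒≡- E₁ G₁ (proj₂ (proj₂ adm₁) s≡t)
        G₂≡ = sum≡0⇒≡- E₂ G₂ (proj₂ (proj₂ adm₂) s≡t)

  shifted-outcome : ShiftedOutcome D E₁ G₁ E₂ G₂
  shifted-outcome = decide (E₁ *ᶻ G₁ ℤ.≟ 0ℤ)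
    where
    decide : Dec (E₁ *ᶻ G₁ ≡ 0ℤ) → ShiftedOutcome D E₁ G₁ E₂ G₂
    decide (yes eq) = combine-degenerate (degenerate adm₁ eq) (degenerate adm₂ (trans (sym product) eq))
    decide (no  ne) = nondegenerate ne

-- Equal leading coefficients: residues and translation

-- The existence of one finite colouring whose large monochromatic solutions all entail `Q`. The
-- conclusion is a parameter because some cases refute solutions outright and others only constrain
-- the coefficients; the threshold `T` leaves room for translations and estimates.
Forced : (ℕ → ℕ → ℕ → ℕ → Set) → Set → Set
Forced S Q = ∃ λ k → Σ (ℕ → Fin k) λ χ → ∃ λ T → ∀ {x y z w} →
  T < x → T < y → T < z → T < w → S x y z w → χ x ≡ χ y → χ x ≡ χ z → χ x ≡ χ w → Q

quadratic : (C E G H x y : ℤ) → ℤ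
quadratic C E G H x y = C *ᶻ x *ᶻ y +ᶻ E *ᶻ x +ᶻ G *ᶻ y +ᶻ H

-- The conclusion of the theorem in coefficients, after multiplication by `D`: equal polynomials,
-- polynomials equal after exchanging the variables, and the exceptional patterns in the two orders
-- of their last terms.
Outcome : (D E₁ G₁ H₁ E₂ G₂ H₂ : ℤ) → Set
Outcome D E₁ G₁ H₁ E₂ G₂ H₂ =
    (E₁ ≡ E₂ × G₁ ≡ G₂ × H₁ ≡ H₂)
  ⊎ (E₁ ≡ G₂ × G₁ ≡ E₂ × H₁ ≡ H₂)
  ⊎ ((E₁ ≡ 0ℤ × G₁ ≡ 0ℤ × H₁ ≡ 0ℤ × H₂ ≡ 0ℤ) × ((E₂ ≡ D × G₂ ≡ 0ℤ) ⊎ (E₂ ≡ 0ℤ × G₂ ≡ D)))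
  ⊎ ((E₂ ≡ 0ℤ × G₂ ≡ 0ℤ × H₁ ≡ 0ℤ × H₂ ≡ 0ℤ) × ((E₁ ≡ D × G₁ ≡ 0ℤ) ⊎ (E₁ ≡ 0ℤ × G₁ ≡ D)))

shift-positive : ∀ r n → ∣ r ∣ < n → ∃ λ k → + n -ᶻ r ≡ + suc k
shift-positive (+ m)        n m<n = go (ℕ.m≤n⇒∃[o]m+o≡n m<n)
  where
  cancel : ∀ a b → (1ℤ +ᶻ a +ᶻ b) -ᶻ a ≡ 1ℤ +ᶻ b
  cancel = solve-∀
  go : ∃ (λ o → suc m ℕ.+ o ≡ n) → ∃ λ k → + n -ᶻ + m ≡ + suc k
  go (o , refl) = o , cancel (+ m) (+ o)
shift-positive (ℤ.-[1+ m ]) n _   = n ℕ.+ m , cong +_ (ℕ.+-suc n m)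

shift-quadratic : ∀ D C E G H r {x y z} →
  D *ᶻ z ≡ quadratic C E G H x y →
  D *ᶻ (z -ᶻ r) ≡ quadratic C (E +ᶻ C *ᶻ r) (G +ᶻ C *ᶻ r) (C *ᶻ r *ᶻ r +ᶻ (E +ᶻ G -ᶻ D) *ᶻ r +ᶻ H) (x -ᶻ r) (y -ᶻ r)
shift-quadratic D C E G H r {x} {y} {z} eq = begin
  D *ᶻ (z -ᶻ r)                                          ≡⟨ left D z r ⟩
  D *ᶻ z -ᶻ D *ᶻ r                                       ≡⟨ cong (_-ᶻ D *ᶻ r) eq ⟩
  (C *ᶻ x *ᶻ y +ᶻ E *ᶻ x +ᶻ G *ᶻ y +ᶻ H) -ᶻ D *ᶻ r       ≡⟨ right D C E G H r x y ⟩
  quadratic C (E +ᶻ C *ᶻ r) (G +ᶻ C *ᶻ r) (C *ᶻ r *ᶻ r +ᶻ (E +ᶻ G -ᶻ D) *ᶻ r +ᶻ H) (x -ᶻ r) (y -ᶻ r) ∎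
  where
  open ≡-Reasoning
  left : ∀ D z r → D *ᶻ (z -ᶻ r) ≡ D *ᶻ z -ᶻ D *ᶻ r
  left = solve-∀
  right : ∀ D C E G H r x y → (C *ᶻ x *ᶻ y +ᶻ E *ᶻ x +ᶻ G *ᶻ y +ᶻ H) -ᶻ D *ᶻ r ≡
    C *ᶻ (x -ᶻ r) *ᶻ (y -ᶻ r) +ᶻ (E +ᶻ C *ᶻ r) *ᶻ (x -ᶻ r) +ᶻ (G +ᶻ C *ᶻ r) *ᶻ (y -ᶻ r) +ᶻ
      (C *ᶻ r *ᶻ r +ᶻ (E +ᶻ G -ᶻ D) *ᶻ r +ᶻ H)
  right = solve-∀

-- Subtracting the equations removes the product, since the leading coefficients agree; `D (z - w)`
-- and a multiple of `x - y` are all that separates the expression from 0.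
linear-congruence : ∀ {k D C E₁ G₁ H₁ E₂ G₂ H₂ x y z w} → k ∣ᶻ x -ᶻ y → k ∣ᶻ z -ᶻ w →
  D *ᶻ z ≡ quadratic C E₁ G₁ H₁ x y → D *ᶻ w ≡ quadratic C E₂ G₂ H₂ x y →
  k ∣ᶻ (E₁ +ᶻ G₁ -ᶻ (E₂ +ᶻ G₂)) *ᶻ x +ᶻ (H₁ -ᶻ H₂)
linear-congruence {k} {D} {C} {E₁} {G₁} {H₁} {E₂} {G₂} {H₂} {x} {y} {z} {w} k∣x-y k∣z-w eq₁ eq₂ =
  subst (k ∣ᶻ_) (sym identity) (∣ᶻ.∣m∣n⇒∣m+n (∣ᶻ.∣n⇒∣m*n D k∣z-w) (∣ᶻ.∣n⇒∣m*n (G₁ -ᶻ G₂) k∣x-y))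
  where
  expand : ∀ C E₁ G₁ H₁ E₂ G₂ H₂ x y → (E₁ +ᶻ G₁ -ᶻ (E₂ +ᶻ G₂)) *ᶻ x +ᶻ (H₁ -ᶻ H₂) ≡
    ((C *ᶻ x *ᶻ y +ᶻ E₁ *ᶻ x +ᶻ G₁ *ᶻ y +ᶻ H₁) -ᶻ (C *ᶻ x *ᶻ y +ᶻ E₂ *ᶻ x +ᶻ G₂ *ᶻ y +ᶻ H₂)) +ᶻ (G₁ -ᶻ G₂) *ᶻ (x -ᶻ y)
  expand = solve-∀
  factor : ∀ D z w n → (D *ᶻ z -ᶻ D *ᶻ w) +ᶻ n ≡ D *ᶻ (z -ᶻ w) +ᶻ n
  factor = solve-∀
  identity : (E₁ +ᶻ G₁ -ᶻ (E₂ +ᶻ G₂)) *ᶻ x +ᶻ (H₁ -ᶻ H₂) ≡ D *ᶻ (z -ᶻ w) +ᶻ (G₁ -ᶻ G₂) *ᶻ (x -ᶻ y)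
  identity = trans (expand C E₁ G₁ H₁ E₂ G₂ H₂ x y)
    (trans (cong₂ (λ a b → (a -ᶻ b) +ᶻ (G₁ -ᶻ G₂) *ᶻ (x -ᶻ y)) (sym eq₁) (sym eq₂))
           (factor D z w ((G₁ -ᶻ G₂) *ᶻ (x -ᶻ y))))

-- By Vieta, `E₁` is a root of the polynomial with roots `E₂` and `G₂`.
same-sum-product : ∀ {E₁ G₁ E₂ G₂} → E₁ +ᶻ G₁ ≡ E₂ +ᶻ G₂ → E₁ *ᶻ G₁ ≡ E₂ *ᶻ G₂ →
  (E₁ ≡ E₂ × G₁ ≡ G₂) ⊎ (E₁ ≡ G₂ × G₁ ≡ E₂)
same-sum-product {E₁} {G₁} {E₂} {G₂} sum product =
  [ (λ h → let e = ℤ.i-j≡0⇒i≡j E₁ E₂ h in inj₁ (e , cancel E₁ G₁ E₂ G₂ sum e))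
  , (λ h → let e = ℤ.i-j≡0⇒i≡j E₁ G₂ h in inj₂ (e , cancel E₁ G₁ G₂ E₂ (trans sum (ℤ.+-comm E₂ G₂)) e))
  ]′ (ℤ.i*j≡0⇒i≡0∨j≡0 (E₁ -ᶻ E₂) vieta)
  where
  cancel : ∀ a b c d → a +ᶻ b ≡ c +ᶻ d → a ≡ c → b ≡ d
  cancel a b c d s refl = trans (shuffle a b) (trans (cong (_-ᶻ a) s) (sym (shuffle a d)))
    where
    shuffle : ∀ a b → b ≡ (a +ᶻ b) -ᶻ a
    shuffle = solve-∀
  expand : ∀ a c d → (a -ᶻ c) *ᶻ (a -ᶻ d) ≡ (a *ᶻ a -ᶻ a *ᶻ (c +ᶻ d)) +ᶻ c *ᶻ d
  expand = solve-∀
  collapse : ∀ a b → (a *ᶻ a -ᶻ a *ᶻ (a +ᶻ b)) +ᶻ a *ᶻ b ≡ 0ℤ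
  collapse = solve-∀
  vieta : (E₁ -ᶻ E₂) *ᶻ (E₁ -ᶻ G₂) ≡ 0ℤ
  vieta = trans (expand E₁ E₂ G₂)
    (trans (cong₂ (λ s q → (E₁ *ᶻ E₁ -ᶻ E₁ *ᶻ s) +ᶻ q) (sym sum) (sym product)) (collapse E₁ G₁))

module EqualLeadingCoefficients
  {D C E₁ G₁ H₁ E₂ G₂ H₂ : ℤ} (D≢0 : D ≢ 0ℤ) (C≢0 : C ≢ 0ℤ)
  (CH₁ : C *ᶻ H₁ ≡ E₁ *ᶻ G₁) (CH₂ : C *ᶻ H₂ ≡ E₂ *ᶻ G₂) where

  Solution : ℕ → ℕ → ℕ → ℕ → Set
  Solution x y z w = D *ᶻ + z ≡ quadratic C E₁ G₁ H₁ (+ x) (+ y) × D *ᶻ + w ≡ quadratic C E₂ G₂ H₂ (+ x) (+ y)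

  Result : Set
  Result = Outcome D E₁ G₁ H₁ E₂ G₂ H₂

  L M : ℤ
  L = E₁ +ᶻ G₁ -ᶻ (E₂ +ᶻ G₂)
  M = H₁ -ᶻ H₂

  congruence : ∀ k .{{_ : NonZero k}} {x y z w} → Solution x y z w →
    x ℕ.mod k ≡ y ℕ.mod k → z ℕ.mod k ≡ w ℕ.mod k →
    + k ∣ᶻ L *ᶻ + x +ᶻ M
  congruence k {x} {y} {z} {w} (eq₁ , eq₂) xy zw =
    linear-congruence {+ k} {D} {C} {E₁} {G₁} {H₁} {E₂} {G₂} {H₂} {+ x} {+ y} {+ z} {+ w}
      (mod-≡⇒∣ x y k xy) (mod-≡⇒∣ z w k zw) eq₁ eq₂

  H-from-product : E₁ *ᶻ G₁ ≡ E₂ *ᶻ G₂ → H₁ ≡ H₂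
  H-from-product eq = ℤ.*-cancelˡ-≡ C H₁ H₂ {{ℤ.≢-nonZero C≢0}} (trans CH₁ (trans eq (sym CH₂)))

  -- The modulus exceeds `∣ M ∣`, so it divides `M` only if `M = 0`. Then `H₁ = H₂`, and the
  -- relation `C H = E G` passes this on to the products.
  vanishing-slope : L ≡ 0ℤ → Forced Solution Result
  vanishing-slope L≡0 = suc ∣ M ∣ , (λ n → n ℕ.mod suc ∣ M ∣) , 0 , λ {x} _ _ _ _ sol xy xz xw →
    conclude (∣∣<⇒≡0 (subst (+ suc ∣ M ∣ ∣ᶻ_) (drop x)
      (congruence (suc ∣ M ∣) sol xy (trans (sym xz) xw))) (ℕ.n<1+n ∣ M ∣))
    where
    drop : ∀ x → L *ᶻ + x +ᶻ M ≡ M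
    drop x = trans (cong (λ l → l *ᶻ + x +ᶻ M) L≡0) (ℤ.+-identityˡ M)
    conclude : M ≡ 0ℤ → Result
    conclude M≡0 = [ (λ (e , g) → inj₁ (e , g , H₁≡H₂)) , (λ (e , g) → inj₂ (inj₁ (e , g , H₁≡H₂))) ]′
      (same-sum-product {E₁} {G₁} {E₂} {G₂} (ℤ.i-j≡0⇒i≡j (E₁ +ᶻ G₁) (E₂ +ᶻ G₂) L≡0)
        (trans (sym CH₁) (trans (cong (C *ᶻ_) H₁≡H₂) CH₂)))
      where
      H₁≡H₂ : H₁ ≡ H₂
      H₁≡H₂ = ℤ.i-j≡0⇒i≡j H₁ H₂ M≡0

  -- The common residue would have to be `- M / L`; when this is not an integer, the modulus `∣ L ∣`
  -- already excludes monochromatic solutions.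
  no-root : L ≢ 0ℤ → ¬ L ∣ᶻ M → Forced Solution Result
  no-root L≢0 L∤M = ∣ L ∣ , (λ n → n ℕ.mod ∣ L ∣) , 0 , λ {x} _ _ _ _ sol xy xz xw →
    ⊥-elim (L∤M (∣ᶻ.∣m+n∣m⇒∣n (∣ᶻ.∣-trans ∣ᶻ.m∣∣m∣ (congruence ∣ L ∣ sol xy (trans (sym xz) xw)))
                              (∣ᶻ.∣m⇒∣m*n (+ x) ∣ᶻ.∣-refl)))
    where
    instance
      L-nonZero : NonZero ∣ L ∣
      L-nonZero = ℤ.≢-nonZero L≢0

  module _ (L≢0 : L ≢ 0ℤ) (r : ℤ) (M≡ : M ≡ -ᶻ r *ᶻ L) where

    -- The constant term of the equation translated by `r`: the value of the quadratic at `(r, r)`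
    -- minus `D r`.
    residue : (E G H : ℤ) → ℤ
    residue E G H = C *ᶻ r *ᶻ r +ᶻ (E +ᶻ G -ᶻ D) *ᶻ r +ᶻ H

    -- One bound for everything that `p` must exceed, both to apply `restricted` to the translated
    -- equation and to make its constant term vanish.
    norm : (E G H : ℤ) → ℕ
    norm E G H = ∣ D ∣ ℕ.+ ∣ C ∣ ℕ.+ (∣ E +ᶻ C *ᶻ r ∣ ℕ.+ ∣ G +ᶻ C *ᶻ r ∣) ℕ.+ ∣ residue E G H ∣

    -- Through `C H = E G` the left side is `C` times the value of the quadratic at `(r, r)`, and
    -- the vanishing residue says that this value is `D r`. The result does not depend on `E`, `G`
    -- or `H`, so it is common to both equations.
    shifted-product : ∀ {E G H} → C *ᶻ H ≡ E *ᶻ G → residue E G H ≡ 0ℤ →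
      (E +ᶻ C *ᶻ r) *ᶻ (G +ᶻ C *ᶻ r) ≡ C *ᶻ D *ᶻ r
    shifted-product {E} {G} {H} CH root = begin
      (E +ᶻ C *ᶻ r) *ᶻ (G +ᶻ C *ᶻ r)                             ≡⟨ expand E G C r ⟩
      E *ᶻ G +ᶻ C *ᶻ (r *ᶻ (E +ᶻ G) +ᶻ C *ᶻ r *ᶻ r)              ≡⟨ cong (_+ᶻ C *ᶻ (r *ᶻ (E +ᶻ G) +ᶻ C *ᶻ r *ᶻ r)) CH ⟨
      C *ᶻ H +ᶻ C *ᶻ (r *ᶻ (E +ᶻ G) +ᶻ C *ᶻ r *ᶻ r)              ≡⟨ collect C D E G H r ⟩
      C *ᶻ (residue E G H +ᶻ D *ᶻ r)                             ≡⟨ cong (λ f → C *ᶻ (f +ᶻ D *ᶻ r)) root ⟩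
      C *ᶻ (0ℤ +ᶻ D *ᶻ r)                                        ≡⟨ simplify C D r ⟩
      C *ᶻ D *ᶻ r                                                ∎
      where
      open ≡-Reasoning
      expand : ∀ E G C r → (E +ᶻ C *ᶻ r) *ᶻ (G +ᶻ C *ᶻ r) ≡ E *ᶻ G +ᶻ C *ᶻ (r *ᶻ (E +ᶻ G) +ᶻ C *ᶻ r *ᶻ r)
      expand = solve-∀
      collect : ∀ C D E G H r → C *ᶻ H +ᶻ C *ᶻ (r *ᶻ (E +ᶻ G) +ᶻ C *ᶻ r *ᶻ r) ≡
        C *ᶻ ((C *ᶻ r *ᶻ r +ᶻ (E +ᶻ G -ᶻ D) *ᶻ r +ᶻ H) +ᶻ D *ᶻ r)
      collect = solve-∀
      simplify : ∀ C D r → C *ᶻ (0ℤ +ᶻ D *ᶻ r) ≡ C *ᶻ D *ᶻ r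
      simplify = solve-∀

    -- Equal coefficients stay equal when the same `C r` is subtracted. In the exceptional cases a
    -- translated product is zero, which forces `C D r = 0` and `r = 0`; each residue then reduces
    -- to its `H`.
    unshift : residue E₁ G₁ H₁ ≡ 0ℤ → residue E₂ G₂ H₂ ≡ 0ℤ →
      ShiftedOutcome D (E₁ +ᶻ C *ᶻ r) (G₁ +ᶻ C *ᶻ r) (E₂ +ᶻ C *ᶻ r) (G₂ +ᶻ C *ᶻ r) → Result
    unshift root₁ root₂ = go
      where
      shuffle : ∀ a c → a ≡ (a +ᶻ c) -ᶻ c
      shuffle = solve-∀
      cancel : ∀ a b → a +ᶻ C *ᶻ r ≡ b +ᶻ C *ᶻ r → a ≡ b
      cancel a b eq = trans (shuffle a (C *ᶻ r)) (trans (cong (_-ᶻ C *ᶻ r) eq) (sym (shuffle b (C *ᶻ r))))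
      r-vanishes : ∀ E G H → C *ᶻ H ≡ E *ᶻ G → residue E G H ≡ 0ℤ → E +ᶻ C *ᶻ r ≡ 0ℤ → r ≡ 0ℤ
      r-vanishes E G H CH root e =
        [ (λ CD≡0 → ⊥-elim ([ C≢0 , D≢0 ]′ (ℤ.i*j≡0⇒i≡0∨j≡0 C CD≡0))) , (λ r≡0 → r≡0) ]′
        (ℤ.i*j≡0⇒i≡0∨j≡0 (C *ᶻ D) (trans (sym (shifted-product {E} {G} {H} CH root)) (cong (_*ᶻ (G +ᶻ C *ᶻ r)) e)))
      zero₁ : E₁ +ᶻ C *ᶻ r ≡ 0ℤ → r ≡ 0ℤ
      zero₁ = r-vanishes E₁ G₁ H₁ CH₁ root₁
      zero₂ : E₂ +ᶻ C *ᶻ r ≡ 0ℤ → r ≡ 0ℤ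
      zero₂ = r-vanishes E₂ G₂ H₂ CH₂ root₂
      at0 : ∀ a {b} → r ≡ 0ℤ → a +ᶻ C *ᶻ r ≡ b → a ≡ b
      at0 a r≡0 eq = trans (sym (trans (cong (λ q → a +ᶻ C *ᶻ q) r≡0) (identity a C))) eq
        where
        identity : ∀ a c → a +ᶻ c *ᶻ 0ℤ ≡ a
        identity = solve-∀
      H≡0 : ∀ E G H → r ≡ 0ℤ → residue E G H ≡ 0ℤ → H ≡ 0ℤ
      H≡0 E G H r≡0 root =
        trans (sym (trans (cong (λ q → C *ᶻ q *ᶻ q +ᶻ (E +ᶻ G -ᶻ D) *ᶻ q +ᶻ H) r≡0)
          (identity C (E +ᶻ G -ᶻ D) H))) root
        where
        identity : ∀ c f h → c *ᶻ 0ℤ *ᶻ 0ℤ +ᶻ f *ᶻ 0ℤ +ᶻ h ≡ h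
        identity = solve-∀
      go : ShiftedOutcome D (E₁ +ᶻ C *ᶻ r) (G₁ +ᶻ C *ᶻ r) (E₂ +ᶻ C *ᶻ r) (G₂ +ᶻ C *ᶻ r) → Result
      go (inj₁ (e , g)) = let e′ = cancel E₁ E₂ e; g′ = cancel G₁ G₂ g in
        inj₁ (e′ , g′ , H-from-product (cong₂ _*ᶻ_ e′ g′))
      go (inj₂ (inj₁ (e , g))) = let e′ = cancel E₁ G₂ e; g′ = cancel G₁ E₂ g in
        inj₂ (inj₁ (e′ , g′ , H-from-product (trans (cong₂ _*ᶻ_ e′ g′) (ℤ.*-comm G₂ E₂))))
      go (inj₂ (inj₂ (inj₁ ((e , g) , inj₁ (e₂ , g₂))))) = let r≡0 = zero₁ e in
        inj₂ (inj₂ (inj₁ (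
          (at0 E₁ r≡0 e , at0 G₁ r≡0 g , H≡0 E₁ G₁ H₁ r≡0 root₁ , H≡0 E₂ G₂ H₂ r≡0 root₂) ,
          inj₁ (at0 E₂ r≡0 e₂ , at0 G₂ r≡0 g₂))))
      go (inj₂ (inj₂ (inj₁ ((e , g) , inj₂ (e₂ , g₂))))) = let r≡0 = zero₁ e in
        inj₂ (inj₂ (inj₁ (
          (at0 E₁ r≡0 e , at0 G₁ r≡0 g , H≡0 E₁ G₁ H₁ r≡0 root₁ , H≡0 E₂ G₂ H₂ r≡0 root₂) ,
          inj₂ (at0 E₂ r≡0 e₂ , at0 G₂ r≡0 g₂))))
      go (inj₂ (inj₂ (inj₂ ((e , g) , inj₁ (e₁ , g₁))))) = let r≡0 = zero₂ e in
        inj₂ (inj₂ (inj₂ (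
          (at0 E₂ r≡0 e , at0 G₂ r≡0 g , H≡0 E₁ G₁ H₁ r≡0 root₁ , H≡0 E₂ G₂ H₂ r≡0 root₂) ,
          inj₁ (at0 E₁ r≡0 e₁ , at0 G₁ r≡0 g₁))))
      go (inj₂ (inj₂ (inj₂ ((e , g) , inj₂ (e₁ , g₁))))) = let r≡0 = zero₂ e in
        inj₂ (inj₂ (inj₂ (
          (at0 E₂ r≡0 e , at0 G₂ r≡0 g , H≡0 E₁ G₁ H₁ r≡0 root₁ , H≡0 E₂ G₂ H₂ r≡0 root₂) ,
          inj₂ (at0 E₁ r≡0 e₁ , at0 G₁ r≡0 g₁))))

    module _ {p : ℕ} (p-prime : Prime p) (norm₁<p : norm E₁ G₁ H₁ < p) (norm₂<p : norm E₂ G₂ H₂ < p) where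

      private instance
        modulus-nonZero : NonZero (∣ L ∣ ℕ.* p)
        modulus-nonZero = ℕ.m*n≢0 ∣ L ∣ p {{ℤ.≢-nonZero L≢0}} {{prime⇒nonZero p-prime}}

      -- The absolute value keeps the translation inside `ℕ`; above the threshold `∣ r ∣` it is the
      -- true difference `n - r`.
      shift : ℕ → ℕ
      shift n = ∣ + n -ᶻ r ∣

      +shift : ∀ n → ∣ r ∣ < n → + shift n ≡ + n -ᶻ r
      +shift n r<n = trans (cong (λ i → + ∣ i ∣) eq) (sym eq)
        where eq = proj₂ (shift-positive r n r<n)

      shift-nonZero : ∀ n → ∣ r ∣ < n → NonZero (shift n)
      shift-nonZero n r<n = subst (λ i → NonZero ∣ i ∣) (sym (proj₂ (shift-positive r n r<n))) _

      -- Every other term of the translated equation is a multiple of `p`, so the residue is one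
      -- too, and being smaller than `p` it vanishes. What remains has no constant term, and
      -- `restricted` applies in both orders of the variables.
      one-equation : ∀ {E G H x y z} → norm E G H < p → ∣ r ∣ < x → ∣ r ∣ < y → ∣ r ∣ < z →
        + p ∣ᶻ + x -ᶻ r → + p ∣ᶻ + y -ᶻ r → + p ∣ᶻ + z -ᶻ r →
        shade p-prime (shift x) ≡ shade p-prime (shift y) → shade p-prime (shift x) ≡ shade p-prime (shift z) →
        D *ᶻ + z ≡ quadratic C E G H (+ x) (+ y) →
        residue E G H ≡ 0ℤ ×
          Admissible D (E +ᶻ C *ᶻ r) (G +ᶻ C *ᶻ r) (valuation p-prime (shift x)) (valuation p-prime (shift y))
      one-equation {E} {G} {H} {x} {y} {z} norm<p r<x r<y r<z p∣x p∣y p∣z xy xz eq =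
        root , proj₁ forwards , proj₁ backwards , proj₂ forwards
        where
        E′ G′ : ℤ
        E′ = E +ᶻ C *ᶻ r
        G′ = G +ᶻ C *ᶻ r
        shifted : D *ᶻ (+ z -ᶻ r) ≡ quadratic C E′ G′ (residue E G H) (+ x -ᶻ r) (+ y -ᶻ r)
        shifted = shift-quadratic D C E G H r {+ x} {+ y} {+ z} eq
        p∣residue : + p ∣ᶻ residue E G H
        p∣residue = ∣ᶻ.∣m+n∣m⇒∣n {m = C *ᶻ (+ x -ᶻ r) *ᶻ (+ y -ᶻ r) +ᶻ E′ *ᶻ (+ x -ᶻ r) +ᶻ G′ *ᶻ (+ y -ᶻ r)}
          (subst (+ p ∣ᶻ_) shifted (∣ᶻ.∣n⇒∣m*n D p∣z))
          (∣ᶻ.∣m∣n⇒∣m+n (∣ᶻ.∣m∣n⇒∣m+n (∣ᶻ.∣n⇒∣m*n (C *ᶻ (+ x -ᶻ r)) p∣y) (∣ᶻ.∣n⇒∣m*n E′ p∣x)) (∣ᶻ.∣n⇒∣m*n G′ p∣y))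
        root : residue E G H ≡ 0ℤ
        root = ∣∣<⇒≡0 p∣residue
          (ℕ.≤-<-trans (ℕ.m≤n+m ∣ residue E G H ∣ (∣ D ∣ ℕ.+ ∣ C ∣ ℕ.+ (∣ E′ ∣ ℕ.+ ∣ G′ ∣))) norm<p)
        bound : ∣ D ∣ ℕ.+ ∣ C ∣ ℕ.+ (∣ E′ ∣ ℕ.+ ∣ G′ ∣) < p
        bound = ℕ.≤-<-trans (ℕ.m≤m+n (∣ D ∣ ℕ.+ ∣ C ∣ ℕ.+ (∣ E′ ∣ ℕ.+ ∣ G′ ∣)) ∣ residue E G H ∣) norm<p
        homogeneous : D *ᶻ (+ z -ᶻ r) ≡ C *ᶻ (+ x -ᶻ r) *ᶻ (+ y -ᶻ r) +ᶻ E′ *ᶻ (+ x -ᶻ r) +ᶻ G′ *ᶻ (+ y -ᶻ r)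
        homogeneous = trans shifted (trans
          (cong (C *ᶻ (+ x -ᶻ r) *ᶻ (+ y -ᶻ r) +ᶻ E′ *ᶻ (+ x -ᶻ r) +ᶻ G′ *ᶻ (+ y -ᶻ r) +ᶻ_) root)
          (ℤ.+-identityʳ (C *ᶻ (+ x -ᶻ r) *ᶻ (+ y -ᶻ r) +ᶻ E′ *ᶻ (+ x -ᶻ r) +ᶻ G′ *ᶻ (+ y -ᶻ r))))
        eq′ : D *ᶻ + shift z ≡ C *ᶻ + shift x *ᶻ + shift y +ᶻ E′ *ᶻ + shift x +ᶻ G′ *ᶻ + shift y
        eq′ = trans (cong (D *ᶻ_) (+shift z r<z)) (trans homogeneous
          (cong₂ (λ a b → C *ᶻ a *ᶻ b +ᶻ E′ *ᶻ a +ᶻ G′ *ᶻ b) (sym (+shift x r<x)) (sym (+shift y r<y))))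
        forwards : Restricted p-prime D E′ G′ (valuation p-prime (shift x)) (valuation p-prime (shift y))
        forwards = restricted p-prime {D} {C} {E′} {G′} (shift x) (shift y) (shift z)
          {{shift-nonZero x r<x}} {{shift-nonZero y r<y}} {{shift-nonZero z r<z}} D≢0 C≢0 bound
          (subst (+ p ∣ᶻ_) (sym (+shift y r<y)) p∣y) xy xz eq′
        backwards : Restricted p-prime D G′ E′ (valuation p-prime (shift y)) (valuation p-prime (shift x))
        backwards = restricted p-prime {D} {C} {G′} {E′} (shift y) (shift x) (shift z)
          {{shift-nonZero y r<y}} {{shift-nonZero x r<x}} {{shift-nonZero z r<z}} D≢0 C≢0
          (subst (λ n → ∣ D ∣ ℕ.+ ∣ C ∣ ℕ.+ n < p) (ℕ.+-comm ∣ E′ ∣ ∣ G′ ∣) bound)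
          (subst (+ p ∣ᶻ_) (sym (+shift x r<x)) p∣x) (sym xy) (trans (sym xy) xz)
          (swap-variables {C} {E′} {G′} {+ shift x} {+ shift y} eq′)

      -- The factor `∣ L ∣` in the modulus is used up in cancelling `L` from `L (x - r)`, which
      -- leaves divisibility of `x - r` by `p`.
      colour : ℕ → Fin ((∣ L ∣ ℕ.* p) ℕ.* (p ℕ.* (p ℕ.* p)))
      colour n = Fin.combine (n ℕ.mod (∣ L ∣ ℕ.* p)) (shade p-prime (shift n))

      integral-root : Forced Solution Result
      integral-root = (∣ L ∣ ℕ.* p) ℕ.* (p ℕ.* (p ℕ.* p)) , colour , ∣ r ∣ ,
        λ {x} {y} {z} {w} r<x r<y r<z r<w sol xy xz xw →
        conclude x y z w r<x r<y r<z r<w sol (modˡ x y xy) (modˡ x z xz) (modˡ x w xw)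
          (shadeʳ x y xy) (shadeʳ x z xz) (shadeʳ x w xw)
        where
        modˡ : ∀ m n → colour m ≡ colour n → m ℕ.mod (∣ L ∣ ℕ.* p) ≡ n ℕ.mod (∣ L ∣ ℕ.* p)
        modˡ m n = Fin.combine-injectiveˡ
          (m ℕ.mod (∣ L ∣ ℕ.* p)) (shade p-prime (shift m)) (n ℕ.mod (∣ L ∣ ℕ.* p)) (shade p-prime (shift n))
        shadeʳ : ∀ m n → colour m ≡ colour n → shade p-prime (shift m) ≡ shade p-prime (shift n)
        shadeʳ m n = Fin.combine-injectiveʳ
          (m ℕ.mod (∣ L ∣ ℕ.* p)) (shade p-prime (shift m)) (n ℕ.mod (∣ L ∣ ℕ.* p)) (shade p-prime (shift n))
        factor : ∀ L x r → L *ᶻ x +ᶻ (-ᶻ r *ᶻ L) ≡ L *ᶻ (x -ᶻ r)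
        factor = solve-∀
        step : ∀ a b r → a -ᶻ r ≡ (a -ᶻ b) +ᶻ (b -ᶻ r)
        step = solve-∀
        p∣shift : ∀ {x} → + (∣ L ∣ ℕ.* p) ∣ᶻ L *ᶻ + x +ᶻ M → + p ∣ᶻ + x -ᶻ r
        p∣shift {x} d = ∣ᶻ.∣ᵤ⇒∣ (ℕ.*-cancelˡ-∣ ∣ L ∣ {{ℤ.≢-nonZero L≢0}}
          (subst (∣ L ∣ ℕ.* p ℕ.∣_)
            (trans (cong ∣_∣ (trans (cong (L *ᶻ + x +ᶻ_) M≡) (factor L (+ x) r))) (ℤ.abs-* L (+ x -ᶻ r)))
            (∣ᶻ.∣⇒∣ᵤ d)))
        p∣other : ∀ x y → x ℕ.mod (∣ L ∣ ℕ.* p) ≡ y ℕ.mod (∣ L ∣ ℕ.* p) → + p ∣ᶻ + x -ᶻ r → + p ∣ᶻ + y -ᶻ r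
        p∣other x y xy d = subst (+ p ∣ᶻ_) (sym (step (+ y) (+ x) r))
          (∣ᶻ.∣m∣n⇒∣m+n (∣ᶻ.∣-trans (∣ᶻ.∣ᵤ⇒∣ (ℕ.n∣m*n ∣ L ∣)) (mod-≡⇒∣ y x (∣ L ∣ ℕ.* p) (sym xy))) d)
        conclude : ∀ x y z w → ∣ r ∣ < x → ∣ r ∣ < y → ∣ r ∣ < z → ∣ r ∣ < w → Solution x y z w →
          x ℕ.mod (∣ L ∣ ℕ.* p) ≡ y ℕ.mod (∣ L ∣ ℕ.* p) →
          x ℕ.mod (∣ L ∣ ℕ.* p) ≡ z ℕ.mod (∣ L ∣ ℕ.* p) →
          x ℕ.mod (∣ L ∣ ℕ.* p) ≡ w ℕ.mod (∣ L ∣ ℕ.* p) →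
          shade p-prime (shift x) ≡ shade p-prime (shift y) →
          shade p-prime (shift x) ≡ shade p-prime (shift z) →
          shade p-prime (shift x) ≡ shade p-prime (shift w) →
          Result
        conclude x y z w r<x r<y r<z r<w sol xy xz xw sxy sxz sxw = unshift (proj₁ first) (proj₁ second)
          (shifted-outcome {D} {E₁ +ᶻ C *ᶻ r} {G₁ +ᶻ C *ᶻ r} {E₂ +ᶻ C *ᶻ r} {G₂ +ᶻ C *ᶻ r} D≢0
            (proj₂ first) (proj₂ second)
            (trans (shifted-product {E₁} {G₁} {H₁} CH₁ (proj₁ first))
              (sym (shifted-product {E₂} {G₂} {H₂} CH₂ (proj₁ second)))))
          where
          p∣x : + p ∣ᶻ + x -ᶻ r
          p∣x = p∣shift {x} (congruence (∣ L ∣ ℕ.* p) {x} {y} {z} {w} sol xy (trans (sym xz) xw))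
          first = one-equation {E₁} {G₁} {H₁} {x} {y} {z} norm₁<p r<x r<y r<z
            p∣x (p∣other x y xy p∣x) (p∣other x z xz p∣x) sxy sxz (proj₁ sol)
          second = one-equation {E₂} {G₂} {H₂} {x} {y} {w} norm₂<p r<x r<y r<w
            p∣x (p∣other x y xy p∣x) (p∣other x w xw p∣x) sxy sxw (proj₂ sol)

  forced : Forced Solution Result
  forced = decide (L ℤ.≟ 0ℤ) (L ∣ᶻ? M)
    where
    decide : Dec (L ≡ 0ℤ) → Dec (L ∣ᶻ M) → Forced Solution Result
    decide (yes L≡0) _        = vanishing-slope L≡0
    decide (no L≢0)  (no L∤M) = no-root L≢0 L∤M
    decide (no L≢0)  (yes (divides q M≡qL)) = integral-root L≢0 r M≡ p-prime
      (ℕ.≤-<-trans (ℕ.m≤m+n n₁ n₂) n<p) (ℕ.≤-<-trans (ℕ.m≤n+m n₂ n₁) n<p)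
      where
      r = -ᶻ q
      M≡ : M ≡ -ᶻ r *ᶻ L
      M≡ = trans M≡qL (cong (_*ᶻ L) (sym (ℤ.neg-involutive q)))
      n₁ = norm L≢0 r M≡ E₁ G₁ H₁
      n₂ = norm L≢0 r M≡ E₂ G₂ H₂
      large = infinitudeOfPrimes (n₁ ℕ.+ n₂)
      p-prime = proj₁ (proj₂ large)
      n<p = proj₂ (proj₂ large)

-- Unequal leading coefficients: a rounded logarithm

module Logarithm (u : ℕ) .{{_ : NonZero u}} where

  shrink : ℕ → ℕ
  shrink n = n ℕ.* u ℕ./ suc u

  shrink-mono : ∀ {m n} → m ≤ n → shrink m ≤ shrink n
  shrink-mono m≤n = ℕ./-monoˡ-≤ (suc u) (ℕ.*-monoˡ-≤ u m≤n)

  shrink-≤ : ∀ n → shrink (suc n) ≤ n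
  shrink-≤ n = ℕ.≤-pred (ℕ.m<n*o⇒m/o<n (ℕ.*-monoʳ-< (suc n) (ℕ.n<1+n u)))

  -- Counts the applications of `shrink` until 0 is reached. The first argument is fuel, and fuel
  -- `n` suffices because `shrink` strictly decreases positive numbers.
  iterations : ℕ → ℕ → ℕ
  iterations zero    _       = 0
  iterations (suc f) zero    = 0
  iterations (suc f) (suc n) = suc (iterations f (shrink (suc n)))

  -- The logarithm of n to the base 1 + 1/u, up to rounding.
  depth : ℕ → ℕ
  depth n = iterations n n

  -- Fuel running out on the left only lowers the count, so only the fuel on the right has to
  -- suffice. With equal arguments this compares different amounts of fuel.
  iterations-mono : ∀ f g {m n} → m ≤ n → n ≤ g → iterations f m ≤ iterations g n
  iterations-mono zero    g       _ _ = z≤n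
  iterations-mono (suc f) g       {zero} _ _ = z≤n
  iterations-mono (suc f) (suc g) {suc m} {suc n} m≤n (s≤s n≤g) =
    s≤s (iterations-mono f g (shrink-mono m≤n) (ℕ.≤-trans (shrink-≤ n) n≤g))

  depth-mono : ∀ {m n} → m ≤ n → depth m ≤ depth n
  depth-mono {m} {n} m≤n = iterations-mono m n m≤n ℕ.≤-refl

  -- The hypothesis says that `m` is at most `shrink n`, so `n` takes at least one step more.
  depth-lower : ∀ {m n} .{{_ : NonZero m}} → suc u ℕ.* m ≤ u ℕ.* n → depth m < depth n
  depth-lower {suc m} {zero}  le = contradiction (subst (suc u ℕ.* suc m ≤_) (ℕ.*-zeroʳ u) le) λ ()
  depth-lower {suc m} {suc n} le = s≤s (iterations-mono (suc m) n {suc m} {shrink (suc n)}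
    (subst (_≤ shrink (suc n)) (ℕ.m*n/n≡m (suc m) (suc u))
      (ℕ./-monoˡ-≤ (suc u) (subst₂ _≤_ (ℕ.*-comm (suc u) (suc m)) (ℕ.*-comm u (suc n)) le))) (shrink-≤ n))

  -- While `n > m`, one step lowers `(u + 1) n` by at least `n`, hence by more than `m`; the excess
  -- `j m` is exhausted after at most `j` steps.
  depth-upper : ∀ j m n → suc u ℕ.* n ≤ suc u ℕ.* m ℕ.+ j ℕ.* m → depth n ≤ depth m ℕ.+ j
  depth-upper zero    m n le =
    ℕ.≤-trans (depth-mono {n} {m} (ℕ.*-cancelˡ-≤ (suc u) (subst (suc u ℕ.* n ≤_) (ℕ.+-identityʳ (suc u ℕ.* m)) le)))
      (ℕ.m≤m+n (depth m) 0)
  depth-upper (suc j) m n le with n ℕ.≤? m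
  ... | yes n≤m = ℕ.≤-trans (depth-mono n≤m) (ℕ.m≤m+n (depth m) (suc j))
  depth-upper (suc j) m zero le | no n≰m = contradiction z≤n n≰m
  depth-upper (suc j) m (suc n) le | no n≰m = begin
    suc (iterations n (shrink (suc n)))
      ≤⟨ s≤s (iterations-mono n (shrink (suc n)) {shrink (suc n)} ℕ.≤-refl ℕ.≤-refl) ⟩
    suc (depth (shrink (suc n)))              ≤⟨ s≤s (depth-upper j m (shrink (suc n)) smaller) ⟩
    suc (depth m ℕ.+ j)                       ≡⟨ ℕ.+-suc (depth m) j ⟨
    depth m ℕ.+ suc j                         ∎
    where
    open ℕ.≤-Reasoning
    smaller : suc u ℕ.* shrink (suc n) ≤ suc u ℕ.* m ℕ.+ j ℕ.* m
    smaller = ℕ.+-cancelʳ-≤ m _ _ (begin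
      suc u ℕ.* shrink (suc n) ℕ.+ m
        ≤⟨ ℕ.+-mono-≤ (subst (_≤ suc n ℕ.* u) (ℕ.*-comm (shrink (suc n)) (suc u))
             (ℕ.m/n*n≤m (suc n ℕ.* u) (suc u))) (ℕ.<⇒≤ (ℕ.≰⇒> n≰m)) ⟩
      suc n ℕ.* u ℕ.+ suc n                     ≡⟨ ℕ.+-comm (suc n ℕ.* u) (suc n) ⟩
      suc n ℕ.+ suc n ℕ.* u                     ≡⟨ cong (suc n ℕ.+_) (ℕ.*-comm (suc n) u) ⟩
      suc u ℕ.* suc n                           ≤⟨ le ⟩
      suc u ℕ.* m ℕ.+ (m ℕ.+ j ℕ.* m)           ≡⟨ cong (suc u ℕ.* m ℕ.+_) (ℕ.+-comm m (j ℕ.* m)) ⟩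
      suc u ℕ.* m ℕ.+ (j ℕ.* m ℕ.+ m)           ≡⟨ ℕ.+-assoc (suc u ℕ.* m) (j ℕ.* m) m ⟨
      suc u ℕ.* m ℕ.+ j ℕ.* m ℕ.+ m             ∎)

-- Each of the three terms is at most a twelfth of `x y`, so together they are at most a quarter.
lower-order : ∀ e g h {x y} → 12 ℕ.* (e ℕ.+ g ℕ.+ h) < x → 12 ℕ.* (e ℕ.+ g ℕ.+ h) < y →
  4 ℕ.* (e ℕ.* x ℕ.+ g ℕ.* y ℕ.+ h) ≤ x ℕ.* y
lower-order e g h {x} {y} K<x K<y = ℕ.*-cancelˡ-≤ 3 (begin
  3 ℕ.* (4 ℕ.* (e ℕ.* x ℕ.+ g ℕ.* y ℕ.+ h))                       ≡⟨ expand e g h x y ⟩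
  x ℕ.* (12 ℕ.* e) ℕ.+ 12 ℕ.* g ℕ.* y ℕ.+ 12 ℕ.* h
    ≤⟨ ℕ.+-mono-≤ (ℕ.+-mono-≤ (ℕ.*-monoʳ-≤ x 12e≤y) (ℕ.*-monoˡ-≤ y 12g≤x)) 12h≤xy ⟩
  x ℕ.* y ℕ.+ x ℕ.* y ℕ.+ x ℕ.* y                                 ≡⟨ triple (x ℕ.* y) ⟩
  3 ℕ.* (x ℕ.* y)                                                 ∎)
  where
  open ℕ.≤-Reasoning
  expand : ∀ e g h x y → 3 ℕ.* (4 ℕ.* (e ℕ.* x ℕ.+ g ℕ.* y ℕ.+ h)) ≡
    x ℕ.* (12 ℕ.* e) ℕ.+ 12 ℕ.* g ℕ.* y ℕ.+ 12 ℕ.* h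
  expand = solveℕ-∀
  triple : ∀ s → s ℕ.+ s ℕ.+ s ≡ 3 ℕ.* s
  triple = solveℕ-∀
  12e≤y : 12 ℕ.* e ≤ y
  12e≤y = ℕ.≤-trans (ℕ.*-monoʳ-≤ 12 (ℕ.≤-trans (ℕ.m≤m+n e g) (ℕ.m≤m+n (e ℕ.+ g) h))) (ℕ.<⇒≤ K<y)
  12g≤x : 12 ℕ.* g ≤ x
  12g≤x = ℕ.≤-trans (ℕ.*-monoʳ-≤ 12 (ℕ.≤-trans (ℕ.m≤n+m g e) (ℕ.m≤m+n (e ℕ.+ g) h))) (ℕ.<⇒≤ K<x)
  12h≤xy : 12 ℕ.* h ≤ x ℕ.* y
  12h≤xy = ℕ.≤-trans (ℕ.*-monoʳ-≤ 12 (ℕ.m≤n+m h (e ℕ.+ g)))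
    (ℕ.≤-trans (ℕ.<⇒≤ K<x) (ℕ.m≤m*n x y {{ℕ.>-nonZero (ℕ.≤-<-trans z≤n K<y)}}))

∣perturbed∣ : ∀ {a b R} → + a ≡ + b +ᶻ R → a ≤ b ℕ.+ ∣ R ∣ × b ≤ a ℕ.+ ∣ R ∣
∣perturbed∣ {a} {b} {R} eq =
  subst (λ i → ∣ i ∣ ≤ b ℕ.+ ∣ R ∣) (sym eq) (ℤ.∣i+j∣≤∣i∣+∣j∣ (+ b) R) ,
  subst (λ i → ∣ i ∣ ≤ a ℕ.+ ∣ R ∣) (trans (cong (_-ᶻ R) eq) (cancel (+ b) R)) (ℤ.∣i-j∣≤∣i∣+∣j∣ (+ a) R)
  where
  cancel : ∀ b R → (b +ᶻ R) -ᶻ R ≡ b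
  cancel = solve-∀

-- So `d z` differs from `c x y` by at most a quarter of `x y`. For distinct integers `c` this
-- leaves a gap of at least half of `x y`.
leading-term : ∀ d c E G H {x y z} →
  12 ℕ.* (∣ E ∣ ℕ.+ ∣ G ∣ ℕ.+ ∣ H ∣) < x → 12 ℕ.* (∣ E ∣ ℕ.+ ∣ G ∣ ℕ.+ ∣ H ∣) < y →
  + d *ᶻ + z ≡ quadratic (+ c) E G H (+ x) (+ y) →
  4 ℕ.* (d ℕ.* z) ≤ (4 ℕ.* c ℕ.+ 1) ℕ.* (x ℕ.* y) × 4 ℕ.* c ℕ.* (x ℕ.* y) ≤ 4 ℕ.* (d ℕ.* z) ℕ.+ x ℕ.* y
leading-term d c E G H {x} {y} {z} K<x K<y eq = upper , lower
  where
  open ℕ.≤-Reasoning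
  R : ℤ
  R = E *ᶻ + x +ᶻ G *ᶻ + y +ᶻ H
  R-small : 4 ℕ.* ∣ R ∣ ≤ x ℕ.* y
  R-small = ℕ.≤-trans (ℕ.*-monoʳ-≤ 4 (ℕ.≤-trans (ℤ.∣i+j∣≤∣i∣+∣j∣ (E *ᶻ + x +ᶻ G *ᶻ + y) H)
    (ℕ.+-monoˡ-≤ ∣ H ∣ (ℕ.≤-trans (ℤ.∣i+j∣≤∣i∣+∣j∣ (E *ᶻ + x) (G *ᶻ + y))
      (ℕ.≤-reflexive (cong₂ ℕ._+_ (ℤ.abs-* E (+ x)) (ℤ.abs-* G (+ y))))))))
    (lower-order (∣ E ∣) (∣ G ∣) (∣ H ∣) K<x K<y)
  assoc : ∀ c E G H x y → c *ᶻ x *ᶻ y +ᶻ E *ᶻ x +ᶻ G *ᶻ y +ᶻ H ≡ c *ᶻ (x *ᶻ y) +ᶻ (E *ᶻ x +ᶻ G *ᶻ y +ᶻ H)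
  assoc = solve-∀
  perturbed : + (d ℕ.* z) ≡ + (c ℕ.* (x ℕ.* y)) +ᶻ R
  perturbed = trans (ℤ.pos-* d z) (trans eq (trans (assoc (+ c) E G H (+ x) (+ y))
    (cong (_+ᶻ R) (trans (cong (+ c *ᶻ_) (sym (ℤ.pos-* x y))) (sym (ℤ.pos-* c (x ℕ.* y)))))))
  bounds = ∣perturbed∣ {d ℕ.* z} {c ℕ.* (x ℕ.* y)} {R} perturbed
  expand : ∀ c s → 4 ℕ.* (c ℕ.* s) ℕ.+ s ≡ (4 ℕ.* c ℕ.+ 1) ℕ.* s
  expand = solveℕ-∀
  upper : 4 ℕ.* (d ℕ.* z) ≤ (4 ℕ.* c ℕ.+ 1) ℕ.* (x ℕ.* y)
  upper = begin
    4 ℕ.* (d ℕ.* z)                                   ≤⟨ ℕ.*-monoʳ-≤ 4 (proj₁ bounds) ⟩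
    4 ℕ.* (c ℕ.* (x ℕ.* y) ℕ.+ ∣ R ∣)                 ≡⟨ ℕ.*-distribˡ-+ 4 (c ℕ.* (x ℕ.* y)) ∣ R ∣ ⟩
    4 ℕ.* (c ℕ.* (x ℕ.* y)) ℕ.+ 4 ℕ.* ∣ R ∣           ≤⟨ ℕ.+-monoʳ-≤ (4 ℕ.* (c ℕ.* (x ℕ.* y))) R-small ⟩
    4 ℕ.* (c ℕ.* (x ℕ.* y)) ℕ.+ x ℕ.* y               ≡⟨ expand c (x ℕ.* y) ⟩
    (4 ℕ.* c ℕ.+ 1) ℕ.* (x ℕ.* y)                     ∎
  lower : 4 ℕ.* c ℕ.* (x ℕ.* y) ≤ 4 ℕ.* (d ℕ.* z) ℕ.+ x ℕ.* y
  lower = begin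
    4 ℕ.* c ℕ.* (x ℕ.* y)                             ≡⟨ ℕ.*-assoc 4 c (x ℕ.* y) ⟩
    4 ℕ.* (c ℕ.* (x ℕ.* y))                           ≤⟨ ℕ.*-monoʳ-≤ 4 (proj₂ bounds) ⟩
    4 ℕ.* (d ℕ.* z ℕ.+ ∣ R ∣)                         ≡⟨ ℕ.*-distribˡ-+ 4 (d ℕ.* z) ∣ R ∣ ⟩
    4 ℕ.* (d ℕ.* z) ℕ.+ 4 ℕ.* ∣ R ∣                   ≤⟨ ℕ.+-monoʳ-≤ (4 ℕ.* (d ℕ.* z)) R-small ⟩
    4 ℕ.* (d ℕ.* z) ℕ.+ x ℕ.* y                       ∎

mod-≡⇒¬close : ∀ {k m n} → m < n → n ≤ m ℕ.+ k → m ℕ.mod suc k ≢ n ℕ.mod suc k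
mod-≡⇒¬close {k} {m} {n} m<n n≤m+k eq = go (ℕ.m≤n⇒∃[o]m+o≡n m<n) n≤m+k eq
  where
  cancel : ∀ m o → (1ℤ +ᶻ m +ᶻ o) -ᶻ m ≡ 1ℤ +ᶻ o
  cancel = solve-∀
  go : ∀ {n} → ∃ (λ o → suc m ℕ.+ o ≡ n) → n ≤ m ℕ.+ k → m ℕ.mod suc k ≢ n ℕ.mod suc k
  go (o , refl) le eq = contradiction
    (∣∣<⇒≡0 {suc k} {+ suc o} (subst (+ suc k ∣ᶻ_) (cancel (+ m) (+ o)) (mod-≡⇒∣ (suc m ℕ.+ o) m (suc k) (sym eq)))
      (s≤s (ℕ.+-cancelˡ-≤ m (suc o) k (subst (_≤ m ℕ.+ k) (sym (ℕ.+-suc m o)) le))))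
    λ ()

-- With `s = x y`, the estimates give `4 d z ≤ u s` and `4 d w ≥ (u + 2) s`, the latter because
-- `4 c₂ - 1 ≥ 4 c₁ + 3`. So `w / z` exceeds the base `(u + 1) / u`, and `w` has the larger depth.
-- Since `c₁ ≥ 1`, also `s ≤ 4 d z`, hence `w ≤ N z`, and the depths differ by at most `j`: too
-- little for a congruence modulo `j + 1`.
unequal-leading-coefficients : ∀ {d c₁ c₂ E₁ G₁ H₁ E₂ G₂ H₂} .{{_ : NonZero d}} .{{_ : NonZero c₁}} → c₁ < c₂ →
  Forced (λ x y z w → + d *ᶻ + z ≡ quadratic (+ c₁) E₁ G₁ H₁ (+ x) (+ y) ×
    + d *ᶻ + w ≡ quadratic (+ c₂) E₂ G₂ H₂ (+ x) (+ y)) ⊥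
unequal-leading-coefficients {d} {c₁} {c₂} {E₁} {G₁} {H₁} {E₂} {G₂} {H₂} c₁<c₂ =
  suc j , (λ n → depth n ℕ.mod suc j) , K₁ ℕ.+ K₂ , λ {x} {y} {z} {w} K<x K<y K<z K<w sol xy xz xw →
    close x y z w (λ le₁ le₂ → mod-≡⇒¬close {j} {depth z} {depth w}
      (depth-lower {z} {w} {{ℕ.>-nonZero (ℕ.≤-<-trans z≤n K<z)}} le₁)
      (depth-upper j z w le₂) (trans (sym xz) xw))
      (leading-term d c₁ E₁ G₁ H₁ {x} {y} {z}
        (ℕ.≤-<-trans (ℕ.m≤m+n K₁ K₂) K<x) (ℕ.≤-<-trans (ℕ.m≤m+n K₁ K₂) K<y) (proj₁ sol))
      (leading-term d c₂ E₂ G₂ H₂ {x} {y} {w}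
        (ℕ.≤-<-trans (ℕ.m≤n+m K₂ K₁) K<x) (ℕ.≤-<-trans (ℕ.m≤n+m K₂ K₁) K<y) (proj₂ sol))
  where
  K₁ K₂ u N j : ℕ
  K₁ = 12 ℕ.* (∣ E₁ ∣ ℕ.+ ∣ G₁ ∣ ℕ.+ ∣ H₁ ∣)
  K₂ = 12 ℕ.* (∣ E₂ ∣ ℕ.+ ∣ G₂ ∣ ℕ.+ ∣ H₂ ∣)
  u = 4 ℕ.* c₁ ℕ.+ 1
  N = 4 ℕ.* c₂ ℕ.+ 1
  j = suc u ℕ.* N
  u-nonZero : NonZero u
  u-nonZero = ℕ.>-nonZero (ℕ.m≤n+m 1 (4 ℕ.* c₁))
  open Logarithm u {{u-nonZero}}
  4d-nonZero : NonZero (4 ℕ.* d)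
  4d-nonZero = ℕ.m*n≢0 4 d
  close : ∀ x y z w → (suc u ℕ.* z ≤ u ℕ.* w → suc u ℕ.* w ≤ suc u ℕ.* z ℕ.+ j ℕ.* z → ⊥) →
    4 ℕ.* (d ℕ.* z) ≤ u ℕ.* (x ℕ.* y) × 4 ℕ.* c₁ ℕ.* (x ℕ.* y) ≤ 4 ℕ.* (d ℕ.* z) ℕ.+ x ℕ.* y →
    4 ℕ.* (d ℕ.* w) ≤ N ℕ.* (x ℕ.* y) × 4 ℕ.* c₂ ℕ.* (x ℕ.* y) ≤ 4 ℕ.* (d ℕ.* w) ℕ.+ x ℕ.* y → ⊥
  close x y z w k (z-upper , z-lower) (w-upper , w-lower) = k
    (ℕ.*-cancelˡ-≤ (4 ℕ.* d) {{4d-nonZero}} (begin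
      4 ℕ.* d ℕ.* (suc u ℕ.* z)             ≡⟨ shuffle d (suc u) z ⟩
      suc u ℕ.* (4 ℕ.* (d ℕ.* z))           ≤⟨ ℕ.*-monoʳ-≤ (suc u) z-upper ⟩
      suc u ℕ.* (u ℕ.* s)                   ≤⟨ ℕ.*-monoˡ-≤ (u ℕ.* s) (ℕ.n≤1+n (suc u)) ⟩
      (2 ℕ.+ u) ℕ.* (u ℕ.* s)               ≡⟨ commute (2 ℕ.+ u) u s ⟩
      u ℕ.* ((2 ℕ.+ u) ℕ.* s)               ≤⟨ ℕ.*-monoʳ-≤ u w-large ⟩
      u ℕ.* (4 ℕ.* (d ℕ.* w))               ≡⟨ shuffle d u w ⟨
      4 ℕ.* d ℕ.* (u ℕ.* w)                 ∎))
    (begin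
      suc u ℕ.* w                           ≤⟨ ℕ.*-monoʳ-≤ (suc u) w≤Nz ⟩
      suc u ℕ.* (N ℕ.* z)                   ≡⟨ ℕ.*-assoc (suc u) N z ⟨
      j ℕ.* z                               ≤⟨ ℕ.m≤n+m (j ℕ.* z) (suc u ℕ.* z) ⟩
      suc u ℕ.* z ℕ.+ j ℕ.* z               ∎)
    where
    open ℕ.≤-Reasoning
    s = x ℕ.* y
    shuffle : ∀ d u z → 4 ℕ.* d ℕ.* (u ℕ.* z) ≡ u ℕ.* (4 ℕ.* (d ℕ.* z))
    shuffle = solveℕ-∀
    commute : ∀ a b c → a ℕ.* (b ℕ.* c) ≡ b ℕ.* (a ℕ.* c)
    commute = solveℕ-∀
    gap : ∀ c s → (2 ℕ.+ (4 ℕ.* c ℕ.+ 1)) ℕ.* s ℕ.+ s ≡ 4 ℕ.* (1 ℕ.+ c) ℕ.* s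
    gap = solveℕ-∀
    w-large : (2 ℕ.+ u) ℕ.* s ≤ 4 ℕ.* (d ℕ.* w)
    w-large = ℕ.+-cancelʳ-≤ s ((2 ℕ.+ u) ℕ.* s) (4 ℕ.* (d ℕ.* w)) (begin
      (2 ℕ.+ u) ℕ.* s ℕ.+ s                 ≡⟨ gap c₁ s ⟩
      4 ℕ.* suc c₁ ℕ.* s                    ≤⟨ ℕ.*-monoˡ-≤ s (ℕ.*-monoʳ-≤ 4 c₁<c₂) ⟩
      4 ℕ.* c₂ ℕ.* s                        ≤⟨ w-lower ⟩
      4 ℕ.* (d ℕ.* w) ℕ.+ s                 ∎)
    s≤4dz : s ≤ 4 ℕ.* (d ℕ.* z)
    s≤4dz = ℕ.+-cancelʳ-≤ s s (4 ℕ.* (d ℕ.* z)) (begin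
      s ℕ.+ s                               ≡⟨ double s ⟩
      2 ℕ.* s                               ≤⟨ ℕ.*-monoˡ-≤ s (ℕ.≤-trans (ℕ.m≤m+n 2 2) (ℕ.m≤m*n 4 c₁)) ⟩
      4 ℕ.* c₁ ℕ.* s                        ≤⟨ z-lower ⟩
      4 ℕ.* (d ℕ.* z) ℕ.+ s                 ∎)
      where
      double : ∀ s → s ℕ.+ s ≡ 2 ℕ.* s
      double = solveℕ-∀
    w≤Nz : w ≤ N ℕ.* z
    w≤Nz = ℕ.*-cancelˡ-≤ (4 ℕ.* d) {{4d-nonZero}} (begin
      4 ℕ.* d ℕ.* w                         ≡⟨ ℕ.*-assoc 4 d w ⟩
      4 ℕ.* (d ℕ.* w)                       ≤⟨ w-upper ⟩
      N ℕ.* s                               ≤⟨ ℕ.*-monoʳ-≤ N s≤4dz ⟩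
      N ℕ.* (4 ℕ.* (d ℕ.* z))               ≡⟨ shuffle d N z ⟨
      4 ℕ.* d ℕ.* (N ℕ.* z)                 ∎)

-- Integers within the rationals and clearing of denominators

ℚ-ring : AlmostCommutativeRing 0ℓ 0ℓ
ℚ-ring = fromCommutativeRing ℚ.+-*-commutativeRing (λ x → dec⇒maybe (0ℚ ℚ.≟ x))

toℚᵘ-fromℤ : ∀ i → ℚ.toℚᵘ (fromℤ i) ℚᵘ.≃ mkℚᵘ i 0
toℚᵘ-fromℤ i = ℚ.toℚᵘ-fromℚᵘ (mkℚᵘ i 0)

fromℤ-injective : ∀ {i j} → fromℤ i ≡ fromℤ j → i ≡ j
fromℤ-injective {i} {j} eq = ℤ.*-cancelʳ-≡ i j 1ℤ
  (ℚᵘ.drop-*≡* (ℚᵘ.≃-trans (ℚᵘ.≃-sym (toℚᵘ-fromℤ i))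
    (ℚᵘ.≃-trans (ℚᵘ.≃-reflexive (cong ℚ.toℚᵘ eq)) (toℚᵘ-fromℤ j))))

fromℤ-+ : ∀ i j → fromℤ (i +ᶻ j) ≡ fromℤ i + fromℤ j
fromℤ-+ i j = ℚ.toℚᵘ-injective (ℚᵘ.≃-trans (toℚᵘ-fromℤ (i +ᶻ j)) (ℚᵘ.≃-trans (*≡* (identity i j))
  (ℚᵘ.≃-trans (ℚᵘ.≃-sym (ℚᵘ.+-cong (toℚᵘ-fromℤ i) (toℚᵘ-fromℤ j))) (ℚᵘ.≃-sym (ℚ.toℚᵘ-homo-+ (fromℤ i) (fromℤ j))))))
  where
  identity : ∀ i j → (i +ᶻ j) *ᶻ 1ℤ ≡ (i *ᶻ 1ℤ +ᶻ j *ᶻ 1ℤ) *ᶻ 1ℤ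
  identity = solve-∀

fromℤ-* : ∀ i j → fromℤ (i *ᶻ j) ≡ fromℤ i * fromℤ j
fromℤ-* i j = ℚ.toℚᵘ-injective (ℚᵘ.≃-trans (toℚᵘ-fromℤ (i *ᶻ j)) (ℚᵘ.≃-trans (*≡* refl)
  (ℚᵘ.≃-trans (ℚᵘ.≃-sym (ℚᵘ.*-cong (toℚᵘ-fromℤ i) (toℚᵘ-fromℤ j))) (ℚᵘ.≃-sym (ℚ.toℚᵘ-homo-* (fromℤ i) (fromℤ j))))))

*-denominator : ∀ q → q * fromℤ (ℚ.↧ q) ≡ fromℤ (ℚ.↥ q)
*-denominator q@(mkℚ n d-1 c) = ℚ.toℚᵘ-injective (ℚᵘ.≃-trans (ℚ.toℚᵘ-homo-* q (fromℤ (+ suc d-1)))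
  (ℚᵘ.≃-trans (ℚᵘ.*-congˡ {mkℚᵘ n d-1} (toℚᵘ-fromℤ (+ suc d-1)))
    (ℚᵘ.≃-trans (*≡* (trans (ℤ.*-identityʳ (n *ᶻ + suc d-1)) (cong (λ k → n *ᶻ + k) (sym (ℕ.*-identityʳ (suc d-1))))))
    (ℚᵘ.≃-sym (toℚᵘ-fromℤ n)))))

positive⇒numerator : ∀ q .{{_ : Positive q}} → ∃ λ e → NonZero e × + e ≡ ℚ.↥ q
positive⇒numerator (mkℚ (+ suc n) _ _) = suc n , _ , refl

*-cancelˡ : ∀ d {p q} → d ≢ 0ℤ → fromℤ d * p ≡ fromℤ d * q → p ≡ q
*-cancelˡ d {p} {q} d≢0 eq = begin
  p                               ≡⟨ restore p ⟨
  ℚ.1/ fromℤ d * (fromℤ d * p)    ≡⟨ cong (ℚ.1/ fromℤ d *_) eq ⟩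
  ℚ.1/ fromℤ d * (fromℤ d * q)    ≡⟨ restore q ⟩
  q                               ∎
  where
  open ≡-Reasoning
  instance
    d-nonZero : ℚ.NonZero (fromℤ d)
    d-nonZero = ℚ.≢-nonZero (λ eq → d≢0 (fromℤ-injective eq))
  restore : ∀ x → ℚ.1/ fromℤ d * (fromℤ d * x) ≡ x
  restore x = trans (sym (ℚ.*-assoc (ℚ.1/ fromℤ d) (fromℤ d) x))
    (trans (cong (_* x) (ℚ.*-inverseˡ (fromℤ d))) (ℚ.*-identityˡ x))

form : (C E G H : ℤ) → Function₂
form C E G H (x , y) = fromℤ C * x * y + fromℤ E * x + fromℤ G * y + fromℤ H

form-fromℤ : ∀ C E G H x y → form C E G H (fromℤ x , fromℤ y) ≡ fromℤ (quadratic C E G H x y)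
form-fromℤ C E G H x y = sym (begin
  fromℤ (C *ᶻ x *ᶻ y +ᶻ E *ᶻ x +ᶻ G *ᶻ y +ᶻ H)
    ≡⟨ fromℤ-+ (C *ᶻ x *ᶻ y +ᶻ E *ᶻ x +ᶻ G *ᶻ y) H ⟩
  fromℤ (C *ᶻ x *ᶻ y +ᶻ E *ᶻ x +ᶻ G *ᶻ y) + fromℤ H
    ≡⟨ cong (_+ fromℤ H) (trans (fromℤ-+ (C *ᶻ x *ᶻ y +ᶻ E *ᶻ x) (G *ᶻ y))
         (cong₂ _+_ (fromℤ-+ (C *ᶻ x *ᶻ y) (E *ᶻ x)) (fromℤ-* G y))) ⟩
  fromℤ (C *ᶻ x *ᶻ y) + fromℤ (E *ᶻ x) + fromℤ G * fromℤ y + fromℤ H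
    ≡⟨ cong₂ (λ a b → a + b + fromℤ G * fromℤ y + fromℤ H)
         (trans (fromℤ-* (C *ᶻ x) y) (cong (_* fromℤ y) (fromℤ-* C x))) (fromℤ-* E x) ⟩
  form C E G H (fromℤ x , fromℤ y) ∎)
  where open ≡-Reasoning

fromℤ-*⁴ : ∀ i j k l → fromℤ (i *ᶻ j *ᶻ k *ᶻ l) ≡ fromℤ i * fromℤ j * fromℤ k * fromℤ l
fromℤ-*⁴ i j k l = trans (fromℤ-* (i *ᶻ j *ᶻ k) l)
  (cong (_* fromℤ l) (trans (fromℤ-* (i *ᶻ j) k) (cong (_* fromℤ k) (fromℤ-* i j))))

-- The extra factor `k` will be the denominator of the other rational coefficient, so that both
-- polynomials are scaled by the same number.
module _ {q : ℚ} {d e : ℤ} (qd≡e : q * fromℤ d ≡ fromℤ e) (k : ℤ) where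

  scaled-leading : ∀ a b → fromℤ (d *ᶻ k) * (q * fromℕ a * fromℕ b) ≡ fromℤ (e *ᶻ k *ᶻ + a *ᶻ + b)
  scaled-leading a b = begin
    fromℤ (d *ᶻ k) * (q * fromℕ a * fromℕ b)          ≡⟨ cong (_* (q * fromℕ a * fromℕ b)) (fromℤ-* d k) ⟩
    fromℤ d * fromℤ k * (q * fromℕ a * fromℕ b)       ≡⟨ regroup q (fromℤ d) (fromℤ k) (fromℕ a) (fromℕ b) ⟩
    q * fromℤ d * fromℤ k * fromℕ a * fromℕ b         ≡⟨ cong (λ t → t * fromℤ k * fromℕ a * fromℕ b) qd≡e ⟩
    fromℤ e * fromℤ k * fromℕ a * fromℕ b             ≡⟨ fromℤ-*⁴ e k (+ a) (+ b) ⟨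
    fromℤ (e *ᶻ k *ᶻ + a *ᶻ + b)                      ∎
    where
    open ≡-Reasoning
    regroup : ∀ q d k a b → d * k * (q * a * b) ≡ q * d * k * a * b
    regroup = solve-ring ℚ-ring

  scaled-bilinear : ∀ a n b m xy → fromℤ (d *ᶻ k) * bilinear q a n b m xy ≡
    form (e *ᶻ k *ᶻ + a *ᶻ + b) (e *ᶻ k *ᶻ + a *ᶻ m) (e *ᶻ k *ᶻ n *ᶻ + b) (e *ᶻ k *ᶻ n *ᶻ m) xy
  scaled-bilinear a n b m xy@(x , y) = begin
    fromℤ (d *ᶻ k) * bilinear q a n b m xy
      ≡⟨ cong (_* bilinear q a n b m xy) (fromℤ-* d k) ⟩
    fromℤ d * fromℤ k * (q * (fromℕ a * x + fromℤ n) * (fromℕ b * y + fromℤ m))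
      ≡⟨ expand q (fromℤ d) (fromℤ k) (fromℕ a) (fromℕ b) (fromℤ n) (fromℤ m) x y ⟩
    monomials (q * fromℤ d)
      ≡⟨ cong monomials qd≡e ⟩
    monomials (fromℤ e)
      ≡⟨ cong₂ _+_ (cong₂ _+_ (cong₂ _+_ (cong (λ c → c * x * y) (sym (fromℤ-*⁴ e k (+ a) (+ b))))
                                         (cong (_* x) (sym (fromℤ-*⁴ e k (+ a) m))))
                              (cong (_* y) (sym (fromℤ-*⁴ e k n (+ b)))))
                   (sym (fromℤ-*⁴ e k n m)) ⟩
    form (e *ᶻ k *ᶻ + a *ᶻ + b) (e *ᶻ k *ᶻ + a *ᶻ m) (e *ᶻ k *ᶻ n *ᶻ + b) (e *ᶻ k *ᶻ n *ᶻ m) xy ∎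
    where
    open ≡-Reasoning
    monomials : ℚ → ℚ
    monomials t = t * fromℤ k * fromℕ a * fromℕ b * x * y + t * fromℤ k * fromℕ a * fromℤ m * x +
      t * fromℤ k * fromℤ n * fromℕ b * y + t * fromℤ k * fromℤ n * fromℤ m
    expand : ∀ q d k a b n m x y → d * k * (q * (a * x + n) * (b * y + m)) ≡
      q * d * k * a * b * x * y + q * d * k * a * m * x + q * d * k * n * b * y + q * d * k * n * m
    expand = solve-ring ℚ-ring

replace-form : ∀ {C E G H C′ E′ G′ H′} → C ≡ C′ → E ≡ E′ → G ≡ G′ → H ≡ H′ → form C E G H ≗ form C′ E′ G′ H′
replace-form refl refl refl refl _ = refl

module _ {D C : ℤ} {q : ℚ} (Dq≡C : fromℤ D * q ≡ fromℤ C) where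

  scaled-product : ∀ ((x , y) : ℚ × ℚ) → fromℤ D * (q * x * y) ≡ form C 0ℤ 0ℤ 0ℤ (x , y)
  scaled-product (x , y) = trans (regroup (fromℤ D) q x y) (cong (λ c → c * x * y + 0ℚ * x + 0ℚ * y + 0ℚ) Dq≡C)
    where
    regroup : ∀ d q x y → d * (q * x * y) ≡ d * q * x * y + 0ℚ * x + 0ℚ * y + 0ℚ
    regroup = solve-ring ℚ-ring

  scaled-product+x : ∀ ((x , y) : ℚ × ℚ) → fromℤ D * (q * x * y + x) ≡ form C D 0ℤ 0ℤ (x , y)
  scaled-product+x (x , y) = trans (regroup (fromℤ D) q x y)
    (cong (λ c → c * x * y + fromℤ D * x + 0ℚ * y + 0ℚ) Dq≡C)
    where
    regroup : ∀ d q x y → d * (q * x * y + x) ≡ d * q * x * y + d * x + 0ℚ * y + 0ℚ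
    regroup = solve-ring ℚ-ring

  scaled-product+y : ∀ ((x , y) : ℚ × ℚ) → fromℤ D * (q * x * y + y) ≡ form C 0ℤ D 0ℤ (x , y)
  scaled-product+y (x , y) = trans (regroup (fromℤ D) q x y)
    (cong (λ c → c * x * y + 0ℚ * x + fromℤ D * y + 0ℚ) Dq≡C)
    where
    regroup : ∀ d q x y → d * (q * x * y + y) ≡ d * q * x * y + 0ℚ * x + d * y + 0ℚ
    regroup = solve-ring ℚ-ring

-- From partition regularity to a single colouring

flip-forced : ∀ {S Q} → Forced (λ x y z w → S x y w z) Q → Forced S Q
flip-forced (k , χ , T , h) = k , χ , T , λ T<x T<y T<z T<w s xy xz xw → h T<x T<y T<w T<z s xy xw xz

restrict-forced : ∀ {S S′ Q} → (∀ {x y z w} → S′ x y z w → S x y z w) → Forced S Q → Forced S′ Q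
restrict-forced S′⇒S (k , χ , T , h) = k , χ , T , λ T<x T<y T<z T<w s → h T<x T<y T<z T<w (S′⇒S s)

-- If `Q` failed, no monochromatic tuple could have all its entries above `T`, and the remaining
-- ones form a finite list. Infinitude is a negation, so this gives only the double negation of `Q`;
-- decidability removes it.
partitionRegular⇒forced : ∀ {P R : Function₂} {Q : Set} → PartitionRegular (X ∷ Y ∷ P ∷ R ∷ []) → Dec Q →
  Forced (λ x y z w → P (fromℕ x , fromℕ y) ≡ fromℕ z × R (fromℕ x , fromℕ y) ≡ fromℕ w) Q → Q
partitionRegular⇒forced {P} {R} {Q} regular Q? (k , χ , T , force) = decidable-stable Q? λ ¬Q →
  regular colouring (constants , cover ¬Q)
  where
  -- Numbers up to T have private colours, so a monochromatic tuple containing one of them is constant.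
  cap : ℕ → Fin (suc (suc T))
  cap n = Fin.fromℕ< {n ℕ.⊓ suc T} (s≤s (ℕ.m⊓n≤n n (suc T)))

  hue : ℕ → Fin (suc (suc T) ℕ.* k)
  hue n = Fin.combine (cap n) (χ n)

  colouring : Colouring (suc (suc T) ℕ.* k)
  colouring n = hue n

  constants : List (List ℚ)
  constants = map (λ n → replicate 4 (fromℕ n)) (upTo (suc T))

  cap-≡ : ∀ m n → hue m ≡ hue n → m ℕ.⊓ suc T ≡ n ℕ.⊓ suc T
  cap-≡ m n eq = begin
    m ℕ.⊓ suc T             ≡⟨ Fin.toℕ-fromℕ< (s≤s (ℕ.m⊓n≤n m (suc T))) ⟨
    Fin.toℕ (cap m)         ≡⟨ cong Fin.toℕ (Fin.combine-injectiveˡ (cap m) (χ m) (cap n) (χ n) eq) ⟩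
    Fin.toℕ (cap n)         ≡⟨ Fin.toℕ-fromℕ< (s≤s (ℕ.m⊓n≤n n (suc T))) ⟩
    n ℕ.⊓ suc T             ∎
    where open ≡-Reasoning

  χ-≡ : ∀ m n → hue m ≡ hue n → χ m ≡ χ n
  χ-≡ m n = Fin.combine-injectiveʳ (cap m) (χ m) (cap n) (χ n)

  large : ∀ m n → T < m → hue m ≡ hue n → T < n
  large m n T<m eq = ℕ.m⊓n≡n⇒n≤m (trans (sym (cap-≡ m n eq)) (ℕ.m≥n⇒m⊓n≡n T<m))

  small : ∀ m n → m ≤ T → hue m ≡ hue n → n ≡ m
  small m n m≤T eq = trans (sym (ℕ.m≤n⇒m⊓n≡m n≤)) (trans (sym (cap-≡ m n eq)) (ℕ.m≤n⇒m⊓n≡m (ℕ.m≤n⇒m≤1+n m≤T)))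
    where
    n≤ : n ≤ suc T
    n≤ = ℕ.≮⇒≥ λ 1+T<n → ℕ.<⇒≱ (large n m (ℕ.<-trans (ℕ.n<1+n T) 1+T<n) (sym eq)) m≤T

  cover : ¬ Q → ∀ {t} → MonochromaticTuple colouring (X ∷ Y ∷ P ∷ R ∷ []) t → t ∈ constants
  cover ¬Q ((u , v , _ , _ , refl) , κ ,
    (u′ , _ , u≡ , cu) ∷ (v′ , _ , v≡ , cv) ∷ (z , _ , Pz , cz) ∷ (w , _ , Rw , cw) ∷ []) =
    decide (T ℕ.<? u)
    where
    u≡u′ : u ≡ u′
    u≡u′ = ℤ.+-injective (fromℤ-injective u≡)
    v≡v′ : v ≡ v′
    v≡v′ = ℤ.+-injective (fromℤ-injective v≡)
    hue-u : hue u ≡ κ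
    hue-u = trans (cong hue u≡u′) cu
    uv : hue u ≡ hue v
    uv = trans hue-u (sym (trans (cong hue v≡v′) cv))
    uz : hue u ≡ hue z
    uz = trans hue-u (sym cz)
    uw : hue u ≡ hue w
    uw = trans hue-u (sym cw)
    decide : Dec (T < u) → fromℕ u ∷ fromℕ v ∷ P (fromℕ u , fromℕ v) ∷ R (fromℕ u , fromℕ v) ∷ [] ∈ constants
    decide (yes T<u) = ⊥-elim (¬Q (force {u} {v} {z} {w} T<u (large u v T<u uv) (large u z T<u uz) (large u w T<u uw)
      (Pz , Rw) (χ-≡ u v uv) (χ-≡ u z uz) (χ-≡ u w uw)))
    decide (no T≮u) = subst (_∈ constants) constant (∈-map⁺ (λ n → replicate 4 (fromℕ n)) (∈-upTo⁺ (s≤s u≤T)))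
      where
      u≤T : u ≤ T
      u≤T = ℕ.≮⇒≥ T≮u
      constant : replicate 4 (fromℕ u) ≡ fromℕ u ∷ fromℕ v ∷ P (fromℕ u , fromℕ v) ∷ R (fromℕ u , fromℕ v) ∷ []
      constant = cong (fromℕ u ∷_) (cong₂ _∷_ (cong fromℕ (sym (small u v u≤T uv)))
        (cong₂ _∷_ (trans (cong fromℕ (sym (small u z u≤T uz))) (sym Pz))
          (cong (_∷ []) (trans (cong fromℕ (sym (small u w u≤T uw))) (sym Rw)))))

-- The given pattern and the conclusion

module BilinearPair
  (q₁ q₂ : ℚ) {{q₁>0 : Positive q₁}} {{q₂>0 : Positive q₂}}
  (a₁ a₂ b₁ b₂ : ℕ)
  {{a₁≢0 : NonZero a₁}} {{a₂≢0 : NonZero a₂}} {{b₁≢0 : NonZero b₁}} {{b₂≢0 : NonZero b₂}}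
  (n₁ n₂ m₁ m₂ : ℤ) where

  d₁ d₂ e₁ e₂ c₁ c₂ d : ℕ
  d₁ = ℚ.↧ₙ q₁
  d₂ = ℚ.↧ₙ q₂
  e₁ = proj₁ (positive⇒numerator q₁)
  e₂ = proj₁ (positive⇒numerator q₂)
  c₁ = e₁ ℕ.* d₂ ℕ.* a₁ ℕ.* b₁
  c₂ = e₂ ℕ.* d₁ ℕ.* a₂ ℕ.* b₂
  d = d₁ ℕ.* d₂

  product≢0 : ∀ i j k l → NonZero i → NonZero j → NonZero k → NonZero l → NonZero (i ℕ.* j ℕ.* k ℕ.* l)
  product≢0 i j k l i≢0 j≢0 k≢0 l≢0 =
    ℕ.m*n≢0 (i ℕ.* j ℕ.* k) l {{ℕ.m*n≢0 (i ℕ.* j) k {{ℕ.m*n≢0 i j {{i≢0}} {{j≢0}}}} {{k≢0}}}} {{l≢0}}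

  denominator≢0 : ∀ q → NonZero (ℚ.↧ₙ q)
  denominator≢0 (mkℚ _ _ _) = _

  c₁≢0 : NonZero c₁
  c₁≢0 = product≢0 e₁ d₂ a₁ b₁ (proj₁ (proj₂ (positive⇒numerator q₁))) (denominator≢0 q₂) a₁≢0 b₁≢0

  c₂≢0 : NonZero c₂
  c₂≢0 = product≢0 e₂ d₁ a₂ b₂ (proj₁ (proj₂ (positive⇒numerator q₂))) (denominator≢0 q₁) a₂≢0 b₂≢0

  d≢0 : NonZero d
  d≢0 = ℕ.m*n≢0 d₁ d₂ {{denominator≢0 q₁}} {{denominator≢0 q₂}}

  pos-product : ∀ i j k l → + i *ᶻ + j *ᶻ + k *ᶻ + l ≡ + (i ℕ.* j ℕ.* k ℕ.* l)
  pos-product i j k l = sym (trans (ℤ.pos-* (i ℕ.* j ℕ.* k) l) (cong (_*ᶻ + l)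
    (trans (ℤ.pos-* (i ℕ.* j) k) (cong (_*ᶻ + k) (ℤ.pos-* i j)))))

  D E₁ G₁ H₁ E₂ G₂ H₂ : ℤ
  D = + d
  E₁ = + e₁ *ᶻ + d₂ *ᶻ + a₁ *ᶻ m₁
  G₁ = + e₁ *ᶻ + d₂ *ᶻ n₁ *ᶻ + b₁
  H₁ = + e₁ *ᶻ + d₂ *ᶻ n₁ *ᶻ m₁
  E₂ = + e₂ *ᶻ + d₁ *ᶻ + a₂ *ᶻ m₂
  G₂ = + e₂ *ᶻ + d₁ *ᶻ n₂ *ᶻ + b₂
  H₂ = + e₂ *ᶻ + d₁ *ᶻ n₂ *ᶻ m₂

  D≢0 : D ≢ 0ℤ
  D≢0 eq = ℕ.≢-nonZero⁻¹ d {{d≢0}} (ℤ.+-injective eq)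

  D≡d₁d₂ : D ≡ + d₁ *ᶻ + d₂
  D≡d₁d₂ = ℤ.pos-* d₁ d₂

  D≡d₂d₁ : D ≡ + d₂ *ᶻ + d₁
  D≡d₂d₁ = trans D≡d₁d₂ (ℤ.*-comm (+ d₁) (+ d₂))

  clear : ∀ q .{{_ : Positive q}} → q * fromℤ (+ ℚ.↧ₙ q) ≡ fromℤ (+ proj₁ (positive⇒numerator q))
  clear q = trans (*-denominator q) (cong fromℤ (sym (proj₂ (proj₂ (positive⇒numerator q)))))

  leading₁ : fromℤ D * (q₁ * fromℕ a₁ * fromℕ b₁) ≡ fromℤ (+ c₁)
  leading₁ = trans (cong (λ D → fromℤ D * (q₁ * fromℕ a₁ * fromℕ b₁)) D≡d₁d₂)
    (trans (scaled-leading {q₁} {+ d₁} {+ e₁} (clear q₁) (+ d₂) a₁ b₁) (cong fromℤ (pos-product e₁ d₂ a₁ b₁)))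

  leading₂ : fromℤ D * (q₂ * fromℕ a₂ * fromℕ b₂) ≡ fromℤ (+ c₂)
  leading₂ = trans (cong (λ D → fromℤ D * (q₂ * fromℕ a₂ * fromℕ b₂)) D≡d₂d₁)
    (trans (scaled-leading {q₂} {+ d₂} {+ e₂} (clear q₂) (+ d₁) a₂ b₂) (cong fromℤ (pos-product e₂ d₁ a₂ b₂)))

  P₁ P₂ : Function₂
  P₁ = bilinear q₁ a₁ n₁ b₁ m₁
  P₂ = bilinear q₂ a₂ n₂ b₂ m₂

  scaled₁ : ∀ xy → fromℤ D * P₁ xy ≡ form (+ c₁) E₁ G₁ H₁ xy
  scaled₁ xy = trans (cong (λ D → fromℤ D * P₁ xy) D≡d₁d₂)
    (trans (scaled-bilinear {q₁} {+ d₁} {+ e₁} (clear q₁) (+ d₂) a₁ n₁ b₁ m₁ xy)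
      (replace-form {E = E₁} {G₁} {H₁} (pos-product e₁ d₂ a₁ b₁) refl refl refl xy))

  scaled₂ : ∀ xy → fromℤ D * P₂ xy ≡ form (+ c₂) E₂ G₂ H₂ xy
  scaled₂ xy = trans (cong (λ D → fromℤ D * P₂ xy) D≡d₂d₁)
    (trans (scaled-bilinear {q₂} {+ d₂} {+ e₂} (clear q₂) (+ d₁) a₂ n₂ b₂ m₂ xy)
      (replace-form {E = E₂} {G₂} {H₂} (pos-product e₂ d₁ a₂ b₂) refl refl refl xy))

  scaled₂-swapped : ∀ xy → fromℤ D * bilinear q₂ b₂ m₂ a₂ n₂ xy ≡ form (+ c₂) G₂ E₂ H₂ xy
  scaled₂-swapped xy = trans (cong (λ D → fromℤ D * bilinear q₂ b₂ m₂ a₂ n₂ xy) D≡d₂d₁)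
    (trans (scaled-bilinear {q₂} {+ d₂} {+ e₂} (clear q₂) (+ d₁) b₂ m₂ a₂ n₂ xy)
      (replace-form (trans (swap (+ e₂ *ᶻ + d₁) (+ b₂) (+ a₂)) (pos-product e₂ d₁ a₂ b₂))
        (swap (+ e₂ *ᶻ + d₁) (+ b₂) n₂) (swap (+ e₂ *ᶻ + d₁) m₂ (+ a₂)) (swap (+ e₂ *ᶻ + d₁) m₂ n₂) xy))
    where
    swap : ∀ i j k → i *ᶻ j *ᶻ k ≡ i *ᶻ k *ᶻ j
    swap = solve-∀

  split-product : ∀ k a b n m → k *ᶻ a *ᶻ b *ᶻ (k *ᶻ n *ᶻ m) ≡ k *ᶻ a *ᶻ m *ᶻ (k *ᶻ n *ᶻ b)
  split-product = solve-∀

  -- This is where it matters that the polynomial is a product of a linear form in `x` and one in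
  -- `y`.
  CH₁ : + c₁ *ᶻ H₁ ≡ E₁ *ᶻ G₁
  CH₁ = trans (cong (_*ᶻ H₁) (sym (pos-product e₁ d₂ a₁ b₁))) (split-product (+ e₁ *ᶻ + d₂) (+ a₁) (+ b₁) n₁ m₁)

  CH₂ : + c₂ *ᶻ H₂ ≡ E₂ *ᶻ G₂
  CH₂ = trans (cong (_*ᶻ H₂) (sym (pos-product e₂ d₁ a₂ b₂))) (split-product (+ e₂ *ᶻ + d₁) (+ a₂) (+ b₂) n₂ m₂)

  Values Equations : ℕ → ℕ → ℕ → ℕ → Set
  Values x y z w = P₁ (fromℕ x , fromℕ y) ≡ fromℕ z × P₂ (fromℕ x , fromℕ y) ≡ fromℕ w
  Equations x y z w = D *ᶻ + z ≡ quadratic (+ c₁) E₁ G₁ H₁ (+ x) (+ y) ×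
    D *ᶻ + w ≡ quadratic (+ c₂) E₂ G₂ H₂ (+ x) (+ y)

  values⇒equations : ∀ x y z w → Values x y z w → Equations x y z w
  values⇒equations x y z w (Pz , Rw) =
    equation (+ c₁) E₁ G₁ H₁ P₁ z scaled₁ Pz , equation (+ c₂) E₂ G₂ H₂ P₂ w scaled₂ Rw
    where
    equation : ∀ C E G H (P : Function₂) z → (∀ xy → fromℤ D * P xy ≡ form C E G H xy) →
      P (fromℕ x , fromℕ y) ≡ fromℕ z → D *ᶻ + z ≡ quadratic C E G H (+ x) (+ y)
    equation C E G H P z scaled Pz = fromℤ-injective (begin
      fromℤ (D *ᶻ + z)                        ≡⟨ fromℤ-* D (+ z) ⟩
      fromℤ D * fromℕ z                       ≡⟨ cong (fromℤ D *_) Pz ⟨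
      fromℤ D * P (fromℕ x , fromℕ y)         ≡⟨ scaled (fromℕ x , fromℕ y) ⟩
      form C E G H (fromℕ x , fromℕ y)        ≡⟨ form-fromℤ C E G H (+ x) (+ y) ⟩
      fromℤ (quadratic C E G H (+ x) (+ y))   ∎)
      where open ≡-Reasoning

  Goal : Set
  Goal =
    let pattern₄ = X ∷ Y ∷ P₁ ∷ P₂ ∷ []
        q = q₁ * fromℕ a₁ * fromℕ b₁
    in
      (P₁ ≗ P₂)
    ⊎ (P₁ ≗ bilinear q₂ b₂ m₂ a₂ n₂)
    ⊎ ( q ≡ q₂ * fromℕ a₂ * fromℕ b₂
      × ( pattern₄ ↭ (X ∷ Y ∷ (λ (x , y) → q * x * y) ∷ (λ (x , y) → q * x * y + x) ∷ [])
        ⊎ pattern₄ ↭ (X ∷ Y ∷ (λ (x , y) → q * x * y) ∷ (λ (x , y) → q * x * y + y) ∷ [])))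

  -- Needed to draw a positive conclusion from partition regularity, which refutes only the negation
  -- of the outcome.
  outcome? : Dec (Outcome D E₁ G₁ H₁ E₂ G₂ H₂)
  outcome? =
    (E₁ ℤ.≟ E₂ ×-dec G₁ ℤ.≟ G₂ ×-dec H₁ ℤ.≟ H₂)
    ⊎-dec (E₁ ℤ.≟ G₂ ×-dec G₁ ℤ.≟ E₂ ×-dec H₁ ℤ.≟ H₂)
    ⊎-dec ((E₁ ℤ.≟ 0ℤ ×-dec G₁ ℤ.≟ 0ℤ ×-dec H₁ ℤ.≟ 0ℤ ×-dec H₂ ℤ.≟ 0ℤ) ×-dec
      ((E₂ ℤ.≟ D ×-dec G₂ ℤ.≟ 0ℤ) ⊎-dec (E₂ ℤ.≟ 0ℤ ×-dec G₂ ℤ.≟ D)))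
    ⊎-dec ((E₂ ℤ.≟ 0ℤ ×-dec G₂ ℤ.≟ 0ℤ ×-dec H₁ ℤ.≟ 0ℤ ×-dec H₂ ℤ.≟ 0ℤ) ×-dec
      ((E₁ ℤ.≟ D ×-dec G₁ ℤ.≟ 0ℤ) ⊎-dec (E₁ ℤ.≟ 0ℤ ×-dec G₁ ℤ.≟ D)))

  same-form : ∀ {C E G H C′ E′ G′ H′} (f g : Function₂) →
    (∀ xy → fromℤ D * f xy ≡ form C E G H xy) → (∀ xy → fromℤ D * g xy ≡ form C′ E′ G′ H′ xy) →
    C ≡ C′ → E ≡ E′ → G ≡ G′ → H ≡ H′ → f ≗ g
  same-form f g scaled-f scaled-g C≡ E≡ G≡ H≡ xy = *-cancelˡ D D≢0
    (trans (scaled-f xy) (trans (replace-form C≡ E≡ G≡ H≡ xy) (sym (scaled-g xy))))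

  conclude : c₁ ≡ c₂ → Outcome D E₁ G₁ H₁ E₂ G₂ H₂ → Goal
  conclude c₁≡c₂ = go
    where
    q : ℚ
    q = q₁ * fromℕ a₁ * fromℕ b₁
    xy-term xy+x-term xy+y-term : Function₂
    xy-term (x , y) = q * x * y
    xy+x-term (x , y) = q * x * y + x
    xy+y-term (x , y) = q * x * y + y
    product = scaled-product {D} {+ c₁} {q} leading₁
    product+x = scaled-product+x {D} {+ c₁} {q} leading₁
    product+y = scaled-product+y {D} {+ c₁} {q} leading₁
    C≡ : + c₁ ≡ + c₂
    C≡ = cong +_ c₁≡c₂
    leading≡ : q ≡ q₂ * fromℕ a₂ * fromℕ b₂
    leading≡ = *-cancelˡ D D≢0 (trans leading₁ (trans (cong fromℤ C≡) (sym leading₂)))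
    in-order : ∀ {f g} → P₁ ≗ f → P₂ ≗ g → (X ∷ Y ∷ P₁ ∷ P₂ ∷ []) ↭ (X ∷ Y ∷ f ∷ g ∷ [])
    in-order P₁≗f P₂≗g = ↭.refl ((λ _ → refl) ∷ (λ _ → refl) ∷ P₁≗f ∷ P₂≗g ∷ [])
    exchanged : ∀ {f g} → P₁ ≗ g → P₂ ≗ f → (X ∷ Y ∷ P₁ ∷ P₂ ∷ []) ↭ (X ∷ Y ∷ f ∷ g ∷ [])
    exchanged P₁≗g P₂≗f = ↭.prep (λ _ → refl) (↭.prep (λ _ → refl) (↭.swap P₁≗g P₂≗f (↭.refl [])))
    go : Outcome D E₁ G₁ H₁ E₂ G₂ H₂ → Goal
    go (inj₁ (e , g , h)) = inj₁ (same-form P₁ P₂ scaled₁ scaled₂ C≡ e g h)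
    go (inj₂ (inj₁ (e , g , h))) =
      inj₂ (inj₁ (same-form P₁ (bilinear q₂ b₂ m₂ a₂ n₂) scaled₁ scaled₂-swapped C≡ e g h))
    go (inj₂ (inj₂ (inj₁ ((e , g , h₁ , h₂) , inj₁ (e′ , g′))))) = inj₂ (inj₂ (leading≡ , inj₁ (in-order
      (same-form P₁ xy-term scaled₁ product (refl {x = + c₁}) e g h₁)
      (same-form P₂ xy+x-term scaled₂ product+x (sym C≡) e′ g′ h₂))))
    go (inj₂ (inj₂ (inj₁ ((e , g , h₁ , h₂) , inj₂ (e′ , g′))))) = inj₂ (inj₂ (leading≡ , inj₂ (in-order
      (same-form P₁ xy-term scaled₁ product (refl {x = + c₁}) e g h₁)
      (same-form P₂ xy+y-term scaled₂ product+y (sym C≡) e′ g′ h₂))))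
    go (inj₂ (inj₂ (inj₂ ((e , g , h₁ , h₂) , inj₁ (e′ , g′))))) = inj₂ (inj₂ (leading≡ , inj₁ (exchanged
      (same-form P₁ xy+x-term scaled₁ product+x (refl {x = + c₁}) e′ g′ h₁)
      (same-form P₂ xy-term scaled₂ product (sym C≡) e g h₂))))
    go (inj₂ (inj₂ (inj₂ ((e , g , h₁ , h₂) , inj₂ (e′ , g′))))) = inj₂ (inj₂ (leading≡ , inj₂ (exchanged
      (same-form P₁ xy+y-term scaled₁ product+y (refl {x = + c₁}) e′ g′ h₁)
      (same-form P₂ xy-term scaled₂ product (sym C≡) e g h₂))))

  theorem : PartitionRegular (X ∷ Y ∷ P₁ ∷ P₂ ∷ []) → Goal
  theorem regular = compare (ℕ.<-cmp c₁ c₂)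
    where
    settle : ∀ {Q} → Dec Q → Forced Equations Q → Q
    settle Q? f = partitionRegular⇒forced {P₁} {P₂} regular Q?
      (restrict-forced {Equations} {Values} (λ {x} {y} {z} {w} → values⇒equations x y z w) f)
    compare : Tri (c₁ < c₂) (c₁ ≡ c₂) (c₂ < c₁) → Goal
    compare (tri< c₁<c₂ _ _) = ⊥-elim (settle (no λ ())
      (unequal-leading-coefficients {d} {c₁} {c₂} {E₁} {G₁} {H₁} {E₂} {G₂} {H₂} {{d≢0}} {{c₁≢0}} c₁<c₂))
    -- The estimate is stated for the smaller coefficient first, so the two equations and the two
    -- values trade places.
    compare (tri> _ _ c₂<c₁) = ⊥-elim (settle (no λ ()) (flip-forced {Equations} (restrict-forced swap×
      (unequal-leading-coefficients {d} {c₂} {c₁} {E₂} {G₂} {H₂} {E₁} {G₁} {H₁} {{d≢0}} {{c₂≢0}} c₂<c₁))))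
      where
      swap× : ∀ {A B : Set} → A × B → B × A
      swap× (a , b) = b , a
    compare (tri≈ _ c₁≡c₂ _) = conclude c₁≡c₂ (settle outcome? (restrict-forced
      (λ {x} {y} {z} {w} (eq₁ , eq₂) → eq₁ ,
        subst (λ c → D *ᶻ + w ≡ quadratic (+ c) E₂ G₂ H₂ (+ x) (+ y)) (sym c₁≡c₂) eq₂)
      (EqualLeadingCoefficients.forced {D} {+ c₁} {E₁} {G₁} {H₁} {E₂} {G₂} {H₂} D≢0 C≢0 CH₁ CH₂′)))
      where
      C≢0 : + c₁ ≢ 0ℤ
      C≢0 eq = ℕ.≢-nonZero⁻¹ c₁ {{c₁≢0}} (ℤ.+-injective eq)
      CH₂′ : + c₁ *ᶻ H₂ ≡ E₂ *ᶻ G₂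
      CH₂′ = trans (cong (λ c → + c *ᶻ H₂) c₁≡c₂) CH₂

theoremD :
  (q₁ q₂ : ℚ) {{_ : Positive q₁}} {{_ : Positive q₂}}
  (a₁ a₂ b₁ b₂ : ℕ)
  {{_ : NonZero a₁}} {{_ : NonZero a₂}} {{_ : NonZero b₁}} {{_ : NonZero b₂}}
  (n₁ n₂ m₁ m₂ : ℤ) →
  let pattern₄ = X ∷ Y ∷ bilinear q₁ a₁ n₁ b₁ m₁ ∷ bilinear q₂ a₂ n₂ b₂ m₂ ∷ []
      q = q₁ * fromℕ a₁ * fromℕ b₁
  in
  PartitionRegular pattern₄ →
    (bilinear q₁ a₁ n₁ b₁ m₁ ≗ bilinear q₂ a₂ n₂ b₂ m₂)
  ⊎ (bilinear q₁ a₁ n₁ b₁ m₁ ≗ bilinear q₂ b₂ m₂ a₂ n₂)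
  ⊎ ( q ≡ q₂ * fromℕ a₂ * fromℕ b₂
    × ( pattern₄ ↭ (X ∷ Y ∷ (λ (x , y) → q * x * y) ∷ (λ (x , y) → q * x * y + x) ∷ [])
      ⊎ pattern₄ ↭ (X ∷ Y ∷ (λ (x , y) → q * x * y) ∷ (λ (x , y) → q * x * y + y) ∷ [])))
theoremD q₁ q₂ a₁ a₂ b₁ b₂ n₁ n₂ m₁ m₂ = BilinearPair.theorem q₁ q₂ a₁ a₂ b₁ b₂ n₁ n₂ m₁ m₂
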